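{- Let $t(n)$ be the number of toothpicks added at stage $n$ of the toothpick structure. Then for all $k\ge0$ and $0\le i\le 2^k-1$, $$ t(2^k+1+i)=\begin{cases} 2\sum_{m\ge0}2^{\mathrm{wt}(i+m)-m}\binom{\mathrm{wt}(i+m)}{m}, & 0\le i\le 2^k-2;\\ 2^{k+1}, & i=2^k-1.\end{cases} $$
   Context: A toothpick is a line segment of length $1$ in the plane. The toothpick structure: at stage $1$ place a single toothpick on the $y$-axis centered at the origin; an end of a toothpick is exposed if that point is neither an end nor the midpoint of any other toothpick; at each subsequent stage, for every exposed toothpick end, place a toothpick centered at that end and perpendicular to the toothpick having that end. $\mathrm{wt}(n)$ denotes the number of $1$'s in the binary expansion of $n$; $\binom{w}{m}=0$ for $m>w$. -}

module Defs where

open import Data.Nat using (ℕ; zero; suc; _+_; _*_; _∸_; _^_; _%_; _/_)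
import Data.Nat as ℕ
open import Data.Nat.Combinatorics using (_C_)
open import Data.Integer as ℤ using (ℤ; +_; -[1+_])
open import Data.Sum using (_⊎_)
open import Data.Product using (_×_; _,_)
open import Data.List using (List; []; _∷_; _++_; length; filter; concatMap; map; upTo)
open import Data.Nat.ListAction using (sum)
open import Relation.Nullary using (Dec; yes; no; _×-dec_; _⊎-dec_)
open import Relation.Binary.PropositionalEquality using (_≡_; refl)

-- Geometry.  All toothpick midpoints and ends lie in (1/2)ℤ², so we
-- use DOUBLED coordinates: the real point (x/2 , y/2) is represented by
-- (x , y) ∈ ℤ × ℤ.  A toothpick of length 1 then has its ends at
-- distance 1 (in doubled coordinates) from its midpoint.

Point : Set
Point = ℤ × ℤ

_≟P_ : (p q : Point) → Dec (p ≡ q)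
(a , b) ≟P (c , d) with a ℤ.≟ c | b ℤ.≟ d
... | yes refl | yes refl = yes refl
... | no a≢c   | _        = no λ { refl → a≢c refl }
... | yes _    | no b≢d   = no λ { refl → b≢d refl }

data Orientation : Set where
  vertical horizontal : Orientation

perp : Orientation → Orientation
perp vertical   = horizontal
perp horizontal = vertical

record Toothpick : Set where
  constructor tp
  field
    mid : Point
    ori : Orientation
open Toothpick public

end₁ end₂ : Toothpick → Point
end₁ (tp (x , y) vertical)   = (x , y ℤ.+ + 1)
end₁ (tp (x , y) horizontal) = (x ℤ.+ + 1 , y)
end₂ (tp (x , y) vertical)   = (x , y ℤ.- + 1)
end₂ (tp (x , y) horizontal) = (x ℤ.- + 1 , y)

touches? : (p : Point) (T : Toothpick) → Dec ((p ≡ end₁ T ⊎ p ≡ end₂ T) ⊎ p ≡ mid T)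
touches? p T = ((p ≟P end₁ T) ⊎-dec (p ≟P end₂ T)) ⊎-dec (p ≟P mid T)

incidence : List Toothpick → Point → ℕ
incidence S p = length (filter (touches? p) S)

-- p (an end of some toothpick of S) is exposed iff the toothpick having
-- that end is the only toothpick of S having p as an end or midpoint,
-- i.e. no OTHER toothpick has p as an end or midpoint.
exposed? : (S : List Toothpick) (p : Point) → Dec (incidence S p ≡ 1)
exposed? S p = incidence S p ℕ.≟ 1

newAt : List Toothpick → Toothpick → List Toothpick
newAt S T = map (λ p → tp p (perp (ori T)))
                (filter (exposed? S) (end₁ T ∷ end₂ T ∷ []))

added : List Toothpick → List Toothpick
added S = concatMap (newAt S) S

initial : Toothpick
initial = tp (+ 0 , + 0) vertical

structure : ℕ → List Toothpick
structure zero          = []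
structure (suc zero)    = initial ∷ []
structure (suc (suc n)) = structure (suc n) ++ added (structure (suc n))

t : ℕ → ℕ
t zero          = 0
t (suc zero)    = 1
t (suc (suc n)) = length (added (structure (suc n)))

-- Binary weight wt(n): number of 1's in the binary expansion of n.
-- (fuel n suffices since n halves at each step)
wtAux : ℕ → ℕ → ℕ
wtAux zero    n = 0
wtAux (suc f) n = n % 2 + wtAux f (n / 2)

wt : ℕ → ℕ
wt n = wtAux n n

-- the summand 2^(wt(i+m)-m) * C(wt(i+m), m); it is 0 when m > wt(i+m)
-- (the C of the stdlib is 0 then), so truncated subtraction is harmless.
term : ℕ → ℕ → ℕ
term i m = 2 ^ (wt (i + m) ∸ m) * (wt (i + m) C m)

-- Σ_{m ≥ 0} term i m.  Only m ≤ i + 1 can give a nonzero term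
-- (a nonzero term needs m ≤ wt(i+m)), so summing over m < i + 8 is exact.
series : ℕ → ℕ
series i = sum (map (term i) (upTo (i + 8)))

{-# OPTIONS --safe #-}

-- Every toothpick has its midpoint at a point of ℤ² whose parity determines its orientation, so the
-- structure is encoded by the age (stage of birth, 0 for never) of each point.  The ends of toothpicks
-- reach a point from two parents, and its age is one more than the smaller parental age, or 0 if the
-- two ages agree.  In the open first quadrant the ages up to 2M, for M = 2^k, fill the block
-- 0 < x < M, 0 < y ≤ M; the block for 2M consists of that block, of two copies of it delayed by 2M
-- (NE, and NW reflected) and of one copy delayed by 2M ∸ 1 (SE, rotated by a right angle).  Hence
-- t(2M + i) = 2 t(i) + t(i + 1) for 0 < i < 2M, and the binomial series satisfies the same recurrence by
-- Pascal's rule.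
module Submission where

open import Defs
open import Data.Nat
open import Data.Nat.Properties
open import Data.Nat.Combinatorics using (_C_; k>n⇒nCk≡0; nCk+nC[k+1]≡[n+1]C[k+1])
open import Data.Nat.Divisibility using (divides-refl)
open import Data.Nat.DivMod using (m/n<m; [m+kn]%n≡m%n; m*n/n≡m; m*n%n≡0; +-distrib-/-∣ʳ)
open import Data.Nat.ListAction using (sum)
open import Data.Nat.Tactic.RingSolver using (solve-∀)
open import Data.Integer as ℤ using (+_; -[1+_]; ∣_∣)
import Data.Integer.Properties as ℤₚ
open import Algebra.Properties.AbelianGroup ℤₚ.+-0-abelianGroup using () renaming (∙-cancelˡ to ℤ-cancelˡ)
open import Algebra.Properties.CommutativeSemigroup +-commutativeSemigroup using (interchange; x∙yz≈y∙xz)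
open import Data.List using (List; []; _∷_; length; filter; concatMap; map; applyUpTo; upTo)
open import Data.List.Properties using (length-map; length-++; map-upTo)
open import Data.List.Membership.Propositional using (_∈_; find; lose)
open import Data.List.Membership.Propositional.Properties
open import Data.List.Membership.Propositional.Properties.WithK using (unique∧set⇒bag)
open import Data.List.Relation.Binary.BagAndSetEquality using (∼bag⇒↭)
open import Data.List.Relation.Binary.Permutation.Propositional.Properties using (↭-length)
open import Data.List.Relation.Unary.All as All using ([]; _∷_)
open import Data.List.Relation.Unary.AllPairs using ([]; _∷_)
open import Data.List.Relation.Unary.Any using (here; there)
open import Data.List.Relation.Unary.Unique.Propositional using (Unique)
import Data.List.Relation.Unary.Unique.Propositional.Properties as Unique
open import Data.Product using (_×_; _,_; proj₁; proj₂; ∃-syntax)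
open import Data.Sum using (_⊎_; inj₁; inj₂)
open import Function using (_∘_; mk⇔)
open import Relation.Binary.Definitions using (tri<; tri≈; tri>)
open import Relation.Binary.PropositionalEquality
open import Relation.Nullary using (Dec; yes; no; ¬_; contradiction)
open import Relation.Unary using (Pred; Decidable)

-- Ages in the first quadrant

-- The delays come from the seed of each copy. With `m` = `M` - 1, the border toothpick at `(m , M)`
-- has age 2`M` and bears the one at `(M , M)` at age 2`M` + 1. The latter plays the initial
-- toothpick for NE and NW. The former, horizontal and one stage older, plays it for SE: hence the
-- right angle and the delay 2`M` - 1. The difficulty lies at the seams, since each block obeys the
-- birth rule with emptiness around it. Three effects protect it. A neighbour that comes no earlier
-- than the child is harmless. Parity selects empty border points as the parents of the points next
-- to a seam. Across the lines `x` = `M` and `y` = `M` beyond `(M , M)` the two parents are equally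
-- old: above the corner by reflection, to its right by a relation between column 1 and row 1 that
-- has to be carried through the induction. On the side of the series, splitting off the leading bit
-- of `i` fails when `i` + 1 or `i` + 2 is a power of two. These are the places where the recurrence
-- for `t` meets the exceptional values of `t` at powers of two, so they are compared separately.

perp² : ∀ o → perp (perp o) ≡ o
perp² vertical   = refl
perp² horizontal = refl

perp-injective : ∀ {o o′} → perp o ≡ perp o′ → o ≡ o′
perp-injective {o} {o′} eq = trans (sym (perp² o)) (trans (cong perp eq) (perp² o′))

par : ℕ → Orientation
par zero    = vertical
par (suc n) = perp (par n)

par-even+ : ∀ {m} n → par m ≡ vertical → par (m + n) ≡ par n
par-even+ {zero}        n eq = refl
par-even+ {suc (suc m)} n eq =
  trans (perp² _) (par-even+ {m} n (trans (sym (perp² _)) eq))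

par-odd+ : ∀ {m} n → par m ≡ horizontal → par (m + n) ≡ perp (par n)
par-odd+ {suc m} n eq = cong perp (par-even+ {m} n (perp-injective eq))

par-balance : ∀ m {n} → par (m + n) ≡ vertical → par m ≡ par n
par-balance m {n} eq with par m in pm
... | vertical   = trans (sym eq) (par-even+ {m} n pm)
... | horizontal = perp-injective (trans (sym eq) (par-odd+ {m} n pm))

odd⇒1≤ : ∀ m → par m ≡ horizontal → 1 ≤ m
odd⇒1≤ (suc m) _ = s≤s z≤n

even-suc⇒1≤ : ∀ m → par (suc m) ≡ vertical → 1 ≤ m
even-suc⇒1≤ (suc m) _ = s≤s z≤n

par-+-congˡ : ∀ {m n} k → par m ≡ par n → par (m + k) ≡ par (n + k)
par-+-congˡ {m} {n} k e with par n in pn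
... | vertical   = trans (par-even+ {m} k e) (sym (par-even+ {n} k pn))
... | horizontal = trans (par-odd+ {m} k e) (sym (par-odd+ {n} k pn))

-- Delays and the birth rule

sh : ℕ → ℕ → ℕ
sh s zero    = zero
sh s (suc n) = s + suc n

-- Age `0` means never, so it counts as infinitely late.
Later : ℕ → ℕ → Set
Later a b = b ≡ 0 ⊎ a < b

Sooner : ℕ → ℕ → Set
Sooner a b = 1 ≤ a × Later a b

-- In a tie both ends reach the point at once and neither is exposed (or both parents are missing).
-- Otherwise the older end is alone at the point for one stage, long enough to bear the toothpick
-- there.
data Rule (a b c : ℕ) : Set where
  tie   : a ≡ b → c ≡ 0 → Rule a b c
  left  : Sooner a b → c ≡ suc a → Rule a b c
  right : Sooner b a → c ≡ suc b → Rule a b c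

rule-swap : ∀ {a b c} → Rule a b c → Rule b a c
rule-swap (tie a≡b c≡0) = tie (sym a≡b) c≡0
rule-swap (left s e)    = right s e
rule-swap (right s e)   = left s e

rule-cong : ∀ {a b c a′ b′ c′} → a′ ≡ a → b′ ≡ b → c′ ≡ c → Rule a b c → Rule a′ b′ c′
rule-cong refl refl refl r = r

sh-sooner : ∀ s {a b} → Sooner a b → Sooner (sh s a) (sh s b)
sh-sooner s {suc a} {zero}  (_ , _)         = m≤n⇒m≤o+n s (s≤s z≤n) , inj₁ refl
sh-sooner s {suc a} {suc b} (_ , inj₂ a<b)  = m≤n⇒m≤o+n s (s≤s z≤n) , inj₂ (+-monoʳ-< s a<b)

sh-suc : ∀ s {a} → 1 ≤ a → sh s (suc a) ≡ suc (sh s a)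
sh-suc s {suc a} _ = +-suc s (suc a)

rule-sh : ∀ s {a b c} → Rule a b c → Rule (sh s a) (sh s b) (sh s c)
rule-sh s (tie refl refl)    = tie refl refl
rule-sh s (left so refl)  = left (sh-sooner s so) (sh-suc s (proj₁ so))
rule-sh s (right so refl) = right (sh-sooner s so) (sh-suc s (proj₁ so))

-- A parent that arrives no earlier than the child changes nothing. So a rule verified with
-- emptiness beyond a border survives when a later block is attached there.
rule-late : ∀ {a b c} → Rule a 0 c → 1 ≤ c → b ≡ 0 ⊎ c ≤ b → Rule a b c
rule-late (tie _ refl) () _
rule-late (left (1≤a , _) refl) _ (inj₁ b≡0) = left (1≤a , inj₁ b≡0) refl
rule-late (left (1≤a , _) refl) _ (inj₂ c≤b) = left (1≤a , inj₂ c≤b) refl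
rule-late (right (() , _) _)

sh-sh : ∀ s a → sh s (sh 1 a) ≡ sh (suc s) a
sh-sh s zero    = refl
sh-sh s (suc a) = +-suc s (suc a)

sh-pos : ∀ s {a} → 1 ≤ a → sh s a ≡ s + a
sh-pos s {suc a} _ = refl

sh1-sh : ∀ s a → sh 1 (sh s a) ≡ sh (suc s) a
sh1-sh s zero    = refl
sh1-sh s (suc a) = sh-pos 1 (m≤n⇒m≤o+n s (s≤s z≤n))

sh-≥ : ∀ s a → sh s a ≡ 0 ⊎ suc s ≤ sh s a
sh-≥ s zero    = inj₁ refl
sh-≥ s (suc a) = inj₂ (subst (suc s ≤_) (sym (+-suc s a)) (s≤s (m≤m+n s a)))

sh-≤ : ∀ s {a b} → a ≤ b → sh s a ≤ s + b
sh-≤ s {zero}  a≤b = z≤n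
sh-≤ s {suc a} a≤b = +-monoʳ-≤ s a≤b

-- The point in question is `(suc x , suc y)`: a vertical toothpick there stems from the left or
-- right, a horizontal one from below or above. The age `c` is a separate argument because at one
-- point `f` will be cut off.
Local : Orientation → (ℕ → ℕ → ℕ) → ℕ → ℕ → ℕ → Set
Local vertical   f x y c = Rule (f x (suc y)) (f (2 + x) (suc y)) c
Local horizontal f x y c = Rule (f (suc x) y) (f (suc x) (2 + y)) c

-- All that doubling has to know of a block. The parameter is `m` rather than `M`, as the last
-- column is `m` and the SE delay is `m + M`.
record Ages (m : ℕ) (f : ℕ → ℕ → ℕ) : Set where
  M : ℕ
  M = suc m
  field
    even-M   : par M ≡ vertical
    f00      : f 0 0 ≡ 1
    f01      : f 0 1 ≡ 2
    f0y      : ∀ y → f 0 (2 + y) ≡ 0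
    fx0      : ∀ x → f (suc x) 0 ≡ 0
    right0   : ∀ {x} y → M ≤ x → f x y ≡ 0
    top0     : ∀ x {y} → M < y → f x y ≡ 0
    bound    : ∀ x y → f x y ≤ M + M
    inner    : ∀ x y → f (suc x) (suc y) ≡ 0 ⊎ 3 ≤ f (suc x) (suc y)
    -- Border data for gluing: the odd border points have the last two ages, too late to disturb or
    -- be disturbed; the even ones are empty, like the axis of the copy beyond.
    col-odd  : ∀ {y} → y < M → par y ≡ horizontal → f m y ≡ m + M
    col-even : ∀ {y} → y < M → par y ≡ vertical → f m y ≡ 0
    row-odd  : ∀ {x} → x < M → par x ≡ horizontal → f x M ≡ M + M
    row-even : ∀ {x} → x < M → par x ≡ vertical → f x M ≡ 0
    -- makes the two parents of (M + x , M) equally old at the next level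
    anti     : ∀ {x} → x < M → par x ≡ horizontal → f 1 (suc x) ≡ sh 1 (f x 1)
    local    : ∀ x y → x < m → y < M → Local (par (x + y)) f x y (f (suc x) (suc y))

-- In the NW case with x = 0 and the SE case with y = 0 the first argument of f is M, where f vanishes.
grow : ℕ → (ℕ → ℕ → ℕ) → ℕ → ℕ → ℕ
grow m f x y with x <? suc m
... | yes _ with y ≤? suc m
...   | yes _ = f x y
...   | no  _ = sh (suc m + suc m) (f (suc m ∸ x) (y ∸ suc m))
grow m f x y | no _ with y <? suc m
...   | yes _ = sh (m + suc m) (f (suc m ∸ y) (suc (x ∸ suc m)))
...   | no  _ = sh (suc m + suc m) (f (x ∸ suc m) (y ∸ suc m))

-- The doubled block, region by region

module _ (m : ℕ) where
  private
    M : ℕ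
    M = suc m

  -- The case distinction of `grow` with its differences replaced by equations; `suc x′` is the
  -- reflected coordinate, the distance to the seam.
  data Region (x y : ℕ) : Set where
    SW : x < M → y ≤ M → Region x y
    NW : ∀ x′ y′ → x + suc x′ ≡ M → y ≡ M + suc y′ → Region x y
    SE : ∀ x′ z → y + suc x′ ≡ M → x ≡ M + z → Region x y
    NE : ∀ x′ y′ → x ≡ M + x′ → y ≡ M + y′ → Region x y

  <⇒gap : ∀ {x n} → x < n → ∃[ d ] x + suc d ≡ n
  <⇒gap {x} {n} x<n = n ∸ suc x , trans (+-suc x _) (m+[n∸m]≡n x<n)

  region : ∀ x y → Region x y
  region x y with x <? M
  ... | yes x<M with y ≤? M
  ...   | yes y≤M = SW x<M y≤M
  ...   | no  y≰M with <⇒gap x<M | <⇒gap (≰⇒> y≰M)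
  ...     | x′ , ex | y′ , ey = NW x′ y′ ex (sym ey)
  region x y | no x≮M with y <? M | sym (m+[n∸m]≡n (≮⇒≥ x≮M))
  ...   | yes y<M | ex = SE _ _ (proj₂ (<⇒gap y<M)) ex
  ...   | no  y≮M | ex = NE _ _ ex (sym (m+[n∸m]≡n (≮⇒≥ y≮M)))

module Grow (m : ℕ) (f : ℕ → ℕ → ℕ) where
  private
    M : ℕ
    M = suc m
    g : ℕ → ℕ → ℕ
    g = grow m f

  grow-SW : ∀ {x y} → x < M → y ≤ M → g x y ≡ f x y
  grow-SW {x} {y} x<M y≤M with x <? M
  ... | no x≮M = contradiction x<M x≮M
  ... | yes _ with y ≤? M
  ...   | yes _   = refl
  ...   | no  y≰M = contradiction y≤M y≰M

  grow-NE : ∀ x y → g (M + x) (M + y) ≡ sh (M + M) (f x y)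
  grow-NE x y with (M + x) <? M
  ... | yes lt = contradiction lt (≤⇒≯ (m≤m+n M x))
  ... | no _ with (M + y) <? M
  ...   | yes lt = contradiction lt (≤⇒≯ (m≤m+n M y))
  ...   | no _ rewrite m+n∸m≡n m x | m+n∸m≡n m y = refl

  ∸-gap : ∀ x {x′ n} → x + x′ ≡ n → n ∸ x ≡ x′
  ∸-gap x {x′} refl = m+n∸m≡n x x′

  gap< : ∀ x {x′ n} → x + suc x′ ≡ n → x < n
  gap< x refl = m<m+n x (s≤s z≤n)

  -- For `x′ = 0` the point lies on the line `x` = `M`, which belongs to NE. The formula persists
  -- since NW and NE are mirror images with this axis in common.
  grow-NW : ∀ x x′ y → x + x′ ≡ M → g x (M + suc y) ≡ sh (M + M) (f x′ (suc y))
  grow-NW x zero y e rewrite trans (sym (+-identityʳ x)) e =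
    subst (λ u → g u (M + suc y) ≡ sh (M + M) (f 0 (suc y))) (+-identityʳ M) (grow-NE 0 (suc y))
  grow-NW x (suc x′) y e with x <? M
  ... | no x≮M = contradiction (gap< x e) x≮M
  ... | yes _ with (M + suc y) ≤? M
  ...   | yes le = contradiction le (<⇒≱ (m<m+n M (s≤s z≤n)))
  ...   | no _ rewrite ∸-gap x e | m+n∸m≡n m (suc y) = refl

  module _ (A : Ages m f) where
    open Ages A hiding (M)

    1≤m : 1 ≤ m
    1≤m = even-suc⇒1≤ m even-M

    odd-m : par m ≡ horizontal
    odd-m = perp-injective even-M

    -- For `x′ = 0` the point lies in row `M`, which belongs to NE. Both descriptions agree there:
    -- the axis of the SE copy runs along this row, and its second toothpick is the first of NE.
    grow-SE : ∀ z y x′ → y + x′ ≡ M → g (M + z) y ≡ sh (m + M) (f x′ (suc z))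
    grow-SE z y zero e rewrite trans (sym (+-identityʳ y)) e = begin
      g (M + z) M               ≡⟨ cong (g (M + z)) (sym (+-identityʳ M)) ⟩
      g (M + z) (M + 0)         ≡⟨ grow-NE z 0 ⟩
      sh (M + M) (f z 0)        ≡⟨ sym (sh-sh (m + M) (f z 0)) ⟩
      sh (m + M) (sh 1 (f z 0)) ≡⟨ cong (sh (m + M)) (base z) ⟩
      sh (m + M) (f 0 (suc z))  ∎
      where
      open ≡-Reasoning
      base : ∀ z → sh 1 (f z 0) ≡ f 0 (suc z)
      base zero    rewrite f00 | f01 = refl
      base (suc z) rewrite fx0 z | f0y z = refl
    grow-SE z y (suc x′) e with (M + z) <? M
    ... | yes lt = contradiction lt (≤⇒≯ (m≤m+n M z))
    ... | no _ with y <? M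
    ...   | no y≮M = contradiction (gap< y e) y≮M
    ...   | yes _ rewrite ∸-gap y e | m+n∸m≡n m z = refl

    M′ : ℕ
    M′ = M + M

    even-M′ : par M′ ≡ vertical
    even-M′ = trans (par-even+ {M} M even-M) even-M

    2≤M : 2 ≤ M
    2≤M = s≤s 1≤m

    grow-00 : g 0 0 ≡ 1
    grow-00 = trans (grow-SW (s≤s z≤n) z≤n) f00

    grow-01 : g 0 1 ≡ 2
    grow-01 = trans (grow-SW (s≤s z≤n) (s≤s z≤n)) f01

    grow-0y : ∀ y → g 0 (2 + y) ≡ 0
    grow-0y y with region m 0 (2 + y)
    ... | SW _ le = trans (grow-SW (s≤s z≤n) le) (f0y y)
    ... | NW x′ y′ ex ey = begin
      g 0 (2 + y)                  ≡⟨ cong (g 0) ey ⟩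
      g 0 (M + suc y′)             ≡⟨ grow-NW 0 (suc x′) y′ ex ⟩
      sh (M + M) (f (suc x′) (suc y′)) ≡⟨ cong (sh (M + M)) (right0 (suc y′) (≤-reflexive (sym ex))) ⟩
      0                            ∎
      where open ≡-Reasoning

    grow-x0 : ∀ x → g (suc x) 0 ≡ 0
    grow-x0 x with region m (suc x) 0
    ... | SW lt _ = trans (grow-SW lt z≤n) (fx0 x)
    ... | SE x′ z ey ex = begin
      g (suc x) 0                  ≡⟨ cong (λ u → g u 0) ex ⟩
      g (M + z) 0                  ≡⟨ grow-SE z 0 (suc x′) ey ⟩
      sh (m + M) (f (suc x′) (suc z)) ≡⟨ cong (sh (m + M)) (right0 (suc z) (≤-reflexive (sym ey))) ⟩
      0                            ∎
      where open ≡-Reasoning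

    grow-right0 : ∀ {x} y → M′ ≤ x → g x y ≡ 0
    grow-right0 {x} y le with region m x y
    ... | SW lt _ = contradiction (≤-trans (≤-trans lt (m≤m+n M M)) le) (<-irrefl refl)
    ... | NW x′ _ ex _ = contradiction (≤-trans (gap< x ex) (≤-trans (m≤m+n M M) le)) (<-irrefl refl)
    ... | SE x′ z ey refl = trans (grow-SE z y (suc x′) ey)
            (cong (sh (m + M)) (top0 (suc x′) (s≤s (+-cancelˡ-≤ M M z le))))
    ... | NE x′ y′ refl refl = trans (grow-NE x′ y′)
            (cong (sh (M + M)) (right0 y′ (+-cancelˡ-≤ M M x′ le)))

    grow-top0 : ∀ x {y} → M′ < y → g x y ≡ 0
    grow-top0 x {y} lt with region m x y
    ... | SW _ le = contradiction (≤-trans lt (≤-trans le (m≤m+n M M))) (<-irrefl refl)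
    ... | NW x′ y′ ex refl = trans (grow-NW x (suc x′) y′ ex)
            (cong (sh (M + M)) (top0 (suc x′) (+-cancelˡ-< M M (suc y′) lt)))
    ... | SE x′ z ey _ = contradiction (≤-trans lt (≤-trans (<⇒≤ (gap< y ey)) (m≤m+n M M))) (<-irrefl refl)
    ... | NE x′ y′ refl refl = trans (grow-NE x′ y′)
            (cong (sh (M + M)) (top0 x′ (+-cancelˡ-< M M y′ lt)))

    grow-bound : ∀ x y → g x y ≤ M′ + M′
    grow-bound x y with region m x y
    ... | SW lt le = subst (_≤ M′ + M′) (sym (grow-SW lt le)) (≤-trans (bound x y) (m≤m+n M′ M′))
    ... | NW x′ y′ ex refl = subst (_≤ M′ + M′) (sym (grow-NW x (suc x′) y′ ex)) (sh-≤ M′ (bound _ (suc y′)))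
    ... | SE x′ z ey refl = subst (_≤ M′ + M′) (sym (grow-SE z y (suc x′) ey))
                              (m≤n⇒m≤1+n (sh-≤ (m + M) (bound _ _)))
    ... | NE x′ y′ refl refl = subst (_≤ M′ + M′) (sym (grow-NE x′ y′)) (sh-≤ M′ (bound _ y′))

    3≤ : ∀ s a → m + M ≤ s → sh s a ≡ 0 ⊎ 3 ≤ sh s a
    3≤ s a le with sh-≥ s a
    ... | inj₁ e = inj₁ e
    ... | inj₂ l = inj₂ (≤-trans (m≤n⇒m≤1+n (≤-trans (+-mono-≤ 1≤m 2≤M) le)) l)

    Early : ℕ → Set
    Early c = c ≡ 0 ⊎ 3 ≤ c

    grow-inner : ∀ x y → Early (g (suc x) (suc y))
    grow-inner x y with region m (suc x) (suc y)
    ... | SW lt le = subst Early (sym (grow-SW lt le)) (inner x y)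
    ... | NW x′ y′ ex refl = subst Early (sym (grow-NW (suc x) (suc x′) y′ ex)) (3≤ M′ (f _ _) (n≤1+n _))
    ... | SE x′ z ey refl = subst Early (sym (grow-SE z (suc y) (suc x′) ey)) (3≤ (m + M) (f _ _) ≤-refl)
    ... | NE x′ y′ refl refl = subst Early (sym (grow-NE x′ y′)) (3≤ M′ (f _ _) (n≤1+n _))

    private
      m+M≡M+m : m + M ≡ M + m
      m+M≡M+m = +-suc m m

      gap-parity : ∀ x {x′} → x + x′ ≡ M → par x′ ≡ par x
      gap-parity x e = sym (par-balance x (trans (cong par e) even-M))

      M+-parity : ∀ x → par (M + x) ≡ par x
      M+-parity x = par-even+ {M} x even-M

      gap<′ : ∀ {x x′} → x + x′ ≡ M → 1 ≤ x → x′ < M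
      gap<′ {suc x} {x′} e _ = subst (suc x′ ≤_) e (s≤s (m≤n+m x′ x))

      row-even′ : ∀ {x} → x ≤ M → par x ≡ vertical → f x M ≡ 0
      row-even′ {x} x≤M p with m≤n⇒m<n∨m≡n x≤M
      ... | inj₁ x<M = row-even x<M p
      ... | inj₂ x≡M = right0 M (≤-reflexive (sym x≡M))

      gap≤ : ∀ x {x′} → x + x′ ≡ M → x′ ≤ M
      gap≤ x {x′} e = subst (x′ ≤_) e (m≤n+m x′ x)

    -- The new last column is the last row of SE, turned, followed by the last column of NE. SE is
    -- delayed one stage less, but its last row is one stage later, so the ages agree.
    grow-col-odd : ∀ {y} → y < M′ → par y ≡ horizontal → g (m + M) y ≡ m + M + M′
    grow-col-odd {y} lt p with region m (m + M) y
    ... | SW l _ = contradiction (≤-trans l (m≤n+m M m)) (<-irrefl refl)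
    ... | NW x′ _ ex _ = contradiction (≤-trans (gap< (m + M) ex) (m≤n+m M m)) (<-irrefl refl)
    ... | SE x′ z ey _ = begin
      g (m + M) y               ≡⟨ cong (λ u → g u y) m+M≡M+m ⟩
      g (M + m) y               ≡⟨ grow-SE m y (suc x′) ey ⟩
      sh (m + M) (f (suc x′) M)
        ≡⟨ cong (sh (m + M)) (row-odd (gap<′ ey (odd⇒1≤ y p)) (trans (gap-parity y ey) p)) ⟩
      m + M + M′                ∎
      where open ≡-Reasoning
    ... | NE x′ y′ _ refl = begin
      g (m + M) (M + y′)        ≡⟨ cong (λ u → g u (M + y′)) m+M≡M+m ⟩
      g (M + m) (M + y′)        ≡⟨ grow-NE m y′ ⟩
      sh M′ (f m y′)
        ≡⟨ cong (sh M′) (col-odd (+-cancelˡ-< M y′ M lt) (trans (sym (M+-parity y′)) p)) ⟩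
      sh M′ (m + M)             ≡⟨ sh-pos M′ (m≤n⇒m≤o+n m (s≤s z≤n)) ⟩
      M′ + (m + M)              ≡⟨ +-comm M′ (m + M) ⟩
      m + M + M′                ∎
      where open ≡-Reasoning

    grow-col-even : ∀ {y} → y < M′ → par y ≡ vertical → g (m + M) y ≡ 0
    grow-col-even {y} lt p with region m (m + M) y
    ... | SW l _ = contradiction (≤-trans l (m≤n+m M m)) (<-irrefl refl)
    ... | NW x′ _ ex _ = contradiction (≤-trans (gap< (m + M) ex) (m≤n+m M m)) (<-irrefl refl)
    ... | SE x′ z ey _ = begin
      g (m + M) y               ≡⟨ cong (λ u → g u y) m+M≡M+m ⟩
      g (M + m) y               ≡⟨ grow-SE m y (suc x′) ey ⟩
      sh (m + M) (f (suc x′) M) ≡⟨ cong (sh (m + M)) (row-even′ (gap≤ y ey) (trans (gap-parity y ey) p)) ⟩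
      0                         ∎
      where open ≡-Reasoning
    ... | NE x′ y′ _ refl = begin
      g (m + M) (M + y′)        ≡⟨ cong (λ u → g u (M + y′)) m+M≡M+m ⟩
      g (M + m) (M + y′)        ≡⟨ grow-NE m y′ ⟩
      sh M′ (f m y′)
        ≡⟨ cong (sh M′) (col-even (+-cancelˡ-< M y′ M lt) (trans (sym (M+-parity y′)) p)) ⟩
      0                         ∎
      where open ≡-Reasoning

    grow-row-odd : ∀ {x} → x < M′ → par x ≡ horizontal → g x M′ ≡ M′ + M′
    grow-row-odd {x} lt p with region m x M′
    ... | SW _ le = contradiction (≤-trans (m<m+n M (s≤s z≤n)) le) (<-irrefl refl)
    ... | NW x′ _ ex _ = trans (grow-NW x (suc x′) m ex)
            (cong (sh M′) (row-odd (gap<′ ex (odd⇒1≤ x p)) (trans (gap-parity x ex) p)))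
    ... | SE _ _ ey _ = contradiction (≤-trans (gap< M′ ey) (m≤m+n M M)) (<-irrefl refl)
    ... | NE x′ _ refl _ = trans (grow-NE x′ M)
            (cong (sh M′) (row-odd (+-cancelˡ-< M x′ M lt) (trans (sym (M+-parity x′)) p)))

    grow-row-even : ∀ {x} → x < M′ → par x ≡ vertical → g x M′ ≡ 0
    grow-row-even {x} lt p with region m x M′
    ... | SW _ le = contradiction (≤-trans (m<m+n M (s≤s z≤n)) le) (<-irrefl refl)
    ... | NW x′ _ ex _ = trans (grow-NW x (suc x′) m ex)
            (cong (sh M′) (row-even′ (gap≤ x ex) (trans (gap-parity x ex) p)))
    ... | SE _ _ ey _ = contradiction (≤-trans (gap< M′ ey) (m≤m+n M M)) (<-irrefl refl)
    ... | NE x′ _ refl _ = trans (grow-NE x′ M)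
            (cong (sh M′) (row-even (+-cancelˡ-< M x′ M lt) (trans (sym (M+-parity x′)) p)))

    -- Beyond the old block, column 1 is the last column of `f` reflected (NW) and row 1 is the same
    -- column turned (SE). The delays of the two copies differ by the required 1.
    grow-anti : ∀ {x} → x < M′ → par x ≡ horizontal → g 1 (suc x) ≡ sh 1 (g x 1)
    grow-anti {x} lt p with region m x 1
    ... | SW x<M _ = trans (grow-SW 2≤M x<M)
            (trans (anti x<M p) (cong (sh 1) (sym (grow-SW x<M (s≤s z≤n)))))
    ... | NW _ y′ _ e = contradiction (suc-injective e) (<⇒≢ (m≤n⇒m≤o+n m (s≤s z≤n)))
    ... | NE _ y′ _ e = contradiction (suc-injective e) (<⇒≢ (≤-trans 1≤m (m≤m+n m y′)))
    ... | SE x′ z ey refl = begin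
      g 1 (suc (M + z))         ≡⟨ cong (g 1) (sym (+-suc M z)) ⟩
      g 1 (M + suc z)           ≡⟨ grow-NW 1 m z refl ⟩
      sh M′ (f m (suc z))       ≡⟨ sym (sh1-sh (m + M) (f m (suc z))) ⟩
      sh 1 (sh (m + M) (f m (suc z))) ≡⟨ cong (sh 1) (sym (grow-SE z 1 m refl)) ⟩
      sh 1 (g (M + z) 1)        ∎
      where open ≡-Reasoning

    -- Only the right column and the top row get a new neighbour. Its age is `0` or at least
    -- `M + M`, hence not below the age of the border point, and `rule-late` applies.
    grow-local-SW : ∀ x y → suc x < M → suc y ≤ M → Local (par (x + y)) g x y (g (suc x) (suc y))
    grow-local-SW x y (s≤s x<m) y<M with par (x + y) in p | local x y x<m y<M
    ... | vertical | r with m≤n⇒m<n∨m≡n x<m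
    ...   | inj₁ 1+x<m = rule-cong (grow-SW (<-trans x<m (n<1+n m)) y<M) (grow-SW (s≤s 1+x<m) y<M) (grow-SW (s≤s x<m) y<M) r
    ...   | inj₂ refl = subst (λ u → Rule u (g (2 + x) (suc y)) (g (suc x) (suc y))) (sym (grow-SW (<-trans x<m (n<1+n m)) y<M))
                         (subst (Rule (f x (suc y)) (g (2 + x) (suc y))) (sym (grow-SW (s≤s x<m) y<M))
                           (rule-late (subst (λ u → Rule (f x (suc y)) u (f m (suc y))) (right0 (suc y) ≤-refl) r) (proj₁ c-range) later))
      where
      even-x : par x ≡ vertical
      even-x = perp-injective odd-m
      odd-1+y : par (suc y) ≡ horizontal
      odd-1+y = cong perp (trans (sym (par-even+ {x} y even-x)) p)
      c-range : 1 ≤ f m (suc y) × f m (suc y) ≤ M + M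
      c-range with m≤n⇒m<n∨m≡n y<M
      ... | inj₁ lt rewrite col-odd lt odd-1+y = m≤n⇒m≤o+n m (s≤s z≤n) , n≤1+n (m + M)
      ... | inj₂ refl rewrite row-odd (n<1+n m) odd-m = s≤s z≤n , ≤-refl
      later : g (2 + x) (suc y) ≡ 0 ⊎ f m (suc y) ≤ g (2 + x) (suc y)
      later with sh-≥ (m + M) (f (m ∸ y) (suc 0))
      ... | q rewrite trans (cong (λ u → g u (suc y)) (sym (+-identityʳ M)))
                       (grow-SE 0 (suc y) (m ∸ y) (cong suc (m+[n∸m]≡n (s≤s⁻¹ y<M)))) with q
      ...   | inj₁ e = inj₁ e
      ...   | inj₂ l = inj₂ (≤-trans (proj₂ c-range) l)
    grow-local-SW x y (s≤s x<m) y<M | horizontal | r with m≤n⇒m<n∨m≡n y<M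
    ...   | inj₁ 1+y<M = rule-cong (grow-SW (s≤s x<m) (<⇒≤ y<M)) (grow-SW (s≤s x<m) 1+y<M) (grow-SW (s≤s x<m) y<M) r
    ...   | inj₂ refl = subst (λ u → Rule u (g (suc x) (2 + y)) (g (suc x) (suc y))) (sym (grow-SW (s≤s x<m) (<⇒≤ y<M)))
                         (subst (Rule (f (suc x) y) (g (suc x) (2 + y))) (sym (grow-SW (s≤s x<m) y<M))
                           (rule-late (subst (λ u → Rule (f (suc x) y) u (f (suc x) M)) (top0 (suc x) ≤-refl) r)
                             (subst (1 ≤_) (sym c≡) (s≤s z≤n)) later))
      where
      even-x : par x ≡ vertical
      even-x = perp-injective (trans (sym (par-odd+ {m} x odd-m)) (trans (cong par (+-comm m x)) p))
      c≡ : f (suc x) M ≡ M + M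
      c≡ = row-odd (s≤s x<m) (cong perp even-x)
      later : g (suc x) (2 + y) ≡ 0 ⊎ f (suc x) M ≤ g (suc x) (2 + y)
      later with sh-≥ M′ (f (M ∸ suc x) 1)
      ... | q rewrite trans (cong (g (suc x)) (+-comm 1 M)) (grow-NW (suc x) (M ∸ suc x) 0 (m+[n∸m]≡n (<⇒≤ (s≤s x<m)))) with q
      ...   | inj₁ e = inj₁ e
      ...   | inj₂ l = inj₂ (≤-trans (≤-trans (≤-reflexive c≡) (n≤1+n _)) l)

    private
      local′ : ∀ {o} x y → x < m → y < M → par (x + y) ≡ o → Local o f x y (f (suc x) (suc y))
      local′ x y x<m y<M refl = local x y x<m y<M

      <m : ∀ x {x′} → suc x + suc x′ ≡ M → x′ < m
      <m x {x′} e = subst (suc x′ ≤_) (suc-injective e) (m≤n+m (suc x′) x)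

    -- Reflection keeps orientations and exchanges left and right parents, hence the `rule-swap` in
    -- the vertical case only.
    grow-local-NW : ∀ o x x′ y′ → suc x + suc x′ ≡ M → y′ < M → par (x′ + y′) ≡ o →
                    Local o g x (M + y′) (g (suc x) (suc (M + y′)))
    grow-local-NW vertical x x′ y′ ex y′<M p
      rewrite sym (+-suc M y′) =
      rule-swap (rule-cong
        (grow-NW (2 + x) x′ y′ (trans (sym (+-suc (suc x) x′)) ex))
        (grow-NW x (2 + x′) y′ (trans (+-suc x (suc x′)) ex))
        (grow-NW (suc x) (suc x′) y′ ex)
        (rule-sh M′ (local′ x′ y′ (<m x ex) y′<M p)))
    grow-local-NW horizontal x x′ y′ ex y′<M p =
      rule-cong (below y′ p)
        (trans (cong (g (suc x)) (trans (cong suc (sym (+-suc M y′))) (sym (+-suc M (suc y′))))) (grow-NW (suc x) (suc x′) (suc y′) ex))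
        (trans (cong (g (suc x)) (sym (+-suc M y′))) (grow-NW (suc x) (suc x′) y′ ex))
        (rule-sh M′ (local′ x′ y′ (<m x ex) y′<M p))
      where
      below : ∀ y′ → par (x′ + y′) ≡ horizontal → g (suc x) (M + y′) ≡ sh M′ (f (suc x′) y′)
      below (suc y′) _ = grow-NW (suc x) (suc x′) y′ ex
      -- The lower parent lies in row `M` of the old block. Its abscissa is even, so it is as empty
      -- as the axis of the copy.
      below zero p = begin
        g (suc x) (M + 0)      ≡⟨ cong (g (suc x)) (+-identityʳ M) ⟩
        g (suc x) M            ≡⟨ grow-SW (gap< (suc x) ex) ≤-refl ⟩
        f (suc x) M
          ≡⟨ row-even (gap< (suc x) ex) (trans (sym (gap-parity (suc x) ex)) (cong perp (trans (cong par (sym (+-identityʳ x′))) p))) ⟩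
        0                      ≡⟨ cong (sh M′) (sym (fx0 x′)) ⟩
        sh M′ (f (suc x′) 0)   ∎
        where open ≡-Reasoning

    -- The right angle exchanges the orientations, hence `perp o`. The left and right parents become
    -- upper and lower ones in reversed order; the lower and upper ones become left and right in the
    -- same order.
    grow-local-SE : ∀ o y x′ z → suc y + suc x′ ≡ M → z < M → par (x′ + z) ≡ o →
                    Local (perp o) g (m + z) y (g (suc (m + z)) (suc y))
    grow-local-SE vertical y x′ z ey z<M p =
      rule-swap (rule-cong
        (grow-SE z (2 + y) x′ (trans (sym (+-suc (suc y) x′)) ey))
        (grow-SE z y (2 + x′) (trans (+-suc y (suc x′)) ey))
        (grow-SE z (suc y) (suc x′) ey)
        (rule-sh (m + M) (local′ x′ z (<m y ey) z<M p)))
    grow-local-SE horizontal y x′ z ey z<M p =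
      rule-cong (before z p)
        (trans (cong (λ u → g u (suc y)) (cong suc (sym (+-suc m z)))) (grow-SE (suc z) (suc y) (suc x′) ey))
        (grow-SE z (suc y) (suc x′) ey)
        (rule-sh (m + M) (local′ x′ z (<m y ey) z<M p))
      where
      before : ∀ z → par (x′ + z) ≡ horizontal → g (m + z) (suc y) ≡ sh (m + M) (f (suc x′) z)
      before (suc z) _ = trans (cong (λ u → g u (suc y)) (+-suc m z)) (grow-SE z (suc y) (suc x′) ey)
      -- The left parent lies in column `m` of the old block, at an even height, and is empty.
      before zero p = begin
        g (m + 0) (suc y)        ≡⟨ cong (λ u → g u (suc y)) (+-identityʳ m) ⟩
        g m (suc y)              ≡⟨ grow-SW (n<1+n m) (<⇒≤ (gap< (suc y) ey)) ⟩
        f m (suc y)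
          ≡⟨ col-even (gap< (suc y) ey) (trans (sym (gap-parity (suc y) ey)) (cong perp (trans (cong par (sym (+-identityʳ x′))) p))) ⟩
        0                        ≡⟨ cong (sh (m + M)) (sym (fx0 x′)) ⟩
        sh (m + M) (f (suc x′) 0) ∎
        where open ≡-Reasoning

    private
      g-at : ∀ {x y x′ y′} → x ≡ M + x′ → y ≡ M + y′ → g x y ≡ sh M′ (f x′ y′)
      g-at refl refl = grow-NE _ _

      1+M : ∀ x → suc (M + x) ≡ M + suc x
      1+M x = sym (+-suc M x)

      2+M : ∀ x → 2 + (M + x) ≡ M + (2 + x)
      2+M x = trans (cong suc (1+M x)) (1+M (suc x))

    grow-local-NE : ∀ o x y → x < m → y < M → par (x + y) ≡ o →
                    Local o g (M + x) (M + y) (g (suc (M + x)) (suc (M + y)))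
    grow-local-NE vertical x y x<m y<M p =
      rule-cong (g-at refl (1+M y)) (g-at (2+M x) (1+M y)) (g-at (1+M x) (1+M y))
        (rule-sh M′ (local′ x y x<m y<M p))
    grow-local-NE horizontal x y x<m y<M p =
      rule-cong (g-at (1+M x) refl) (g-at (1+M x) (2+M y)) (g-at (1+M x) (1+M y))
        (rule-sh M′ (local′ x y x<m y<M p))

    -- The border toothpick at `(m , M)` is the only parent, so NE and NW are born here at age 2`M`
    -- + 1.
    grow-local-corner : Local vertical g m m (g M M)
    grow-local-corner = rule-cong
      (trans (grow-SW (n<1+n m) ≤-refl) (row-odd (n<1+n m) odd-m))
      (trans (g-at {x′ = 1} (+-comm 1 M) (sym (+-identityʳ M))) (cong (sh M′) (fx0 0)))
      (trans (g-at {x′ = 0} (sym (+-identityʳ M)) (sym (+-identityʳ M))) (cong (sh M′) f00))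
      (left {a = M′} {b = 0} (s≤s z≤n , inj₁ refl) (+-comm M′ 1))

    -- Left and right parents are mirror images and tie. Of the parents on the line itself only
    -- `(M , M)` is present; it bears the toothpick above it.
    grow-local-north : ∀ o y → par y ≡ o → Local (perp o) g m (M + y) (g M (suc (M + y)))
    grow-local-north horizontal (suc y) p =
      rule-cong
        (trans (cong (g m) (sym (+-suc M (suc y)))) (grow-NW m 1 (suc y) (+-comm m 1)))
        (g-at {x′ = 1} (+-comm 1 M) (sym (+-suc M (suc y))))
        (trans (g-at {x′ = 0} (sym (+-identityʳ M)) (sym (+-suc M (suc y)))) (cong (sh M′) (f0y y)))
        (tie refl refl)
    grow-local-north vertical zero p =
      rule-cong
        (trans (g-at {x′ = 0} (sym (+-identityʳ M)) refl) (cong (sh M′) f00))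
        (trans (g-at {x′ = 0} (sym (+-identityʳ M)) (2+M 0)) (cong (sh M′) (f0y 0)))
        (trans (g-at {x′ = 0} (sym (+-identityʳ M)) (sym (+-suc M 0))) (cong (sh M′) f01))
        (left (m≤n⇒m≤o+n M′ (s≤s z≤n) , inj₁ refl) (+-suc M′ 1))
    grow-local-north vertical (suc (suc y)) p =
      rule-cong
        (trans (g-at {x′ = 0} (sym (+-identityʳ M)) refl) (cong (sh M′) (f0y y)))
        (trans (g-at {x′ = 0} (sym (+-identityʳ M)) (2+M _)) (cong (sh M′) (f0y (2 + y))))
        (trans (g-at {x′ = 0} (sym (+-identityʳ M)) (sym (+-suc M _))) (cong (sh M′) (f0y (1 + y))))
        (tie refl refl)

    -- Row `M` stays empty to the right of the corner. For even `x` the lower parent is in SE and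
    -- the upper one in NE; the extra stage in `anti` makes up for the shorter delay of SE, and they
    -- tie.
    grow-local-east : ∀ o x → x < m → par x ≡ o → Local (perp o) g (M + x) m (g (suc (M + x)) M)
    grow-local-east horizontal (suc x) x<m p =
      rule-cong
        (trans (g-at refl (sym (+-identityʳ M))) (cong (sh M′) (fx0 x)))
        (trans (g-at (2+M _) (sym (+-identityʳ M))) (cong (sh M′) (fx0 (2 + x))))
        (trans (g-at (sym (+-suc M _)) (sym (+-identityʳ M))) (cong (sh M′) (fx0 (1 + x))))
        (tie refl refl)
    grow-local-east vertical x x<m p =
      rule-cong
        (trans (cong (λ u → g u m) (sym (+-suc M x))) (grow-SE (suc x) m 1 (+-comm m 1)))
        (trans (g-at (sym (+-suc M x)) (+-comm 1 M)) refl)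
        (trans (g-at (sym (+-suc M x)) (sym (+-identityʳ M))) (cong (sh M′) (fx0 x)))
        (tie tied refl)
      where
      tied : sh (m + M) (f 1 (2 + x)) ≡ sh M′ (f (suc x) 1)
      tied = trans (cong (sh (m + M)) (anti (s≤s x<m) (cong perp p))) (sh-sh (m + M) (f (suc x) 1))

    private
      par-m+m : par (m + m) ≡ vertical
      par-m+m = trans (par-odd+ {m} m odd-m) (cong perp odd-m)

      parity-NW : ∀ x x′ y′ → suc x + suc x′ ≡ M → par (x′ + y′) ≡ par (x + (M + y′))
      parity-NW x x′ y′ ex = begin
        par (x′ + y′)        ≡⟨ par-+-congˡ {x′} {x} y′ (perp-injective {par x′} (gap-parity (suc x) ex)) ⟩
        par (x + y′)         ≡⟨ sym (M+-parity (x + y′)) ⟩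
        par (M + (x + y′))   ≡⟨ cong par (x∙yz≈y∙xz M x y′) ⟩
        par (x + (M + y′))   ∎
        where open ≡-Reasoning

      parity-SE : ∀ y x′ z → suc y + suc x′ ≡ M → perp (par (x′ + z)) ≡ par (m + z + y)
      parity-SE y x′ z ey = begin
        perp (par (x′ + z))
          ≡⟨ cong perp (par-+-congˡ {x′} {y} z (perp-injective {par x′} (gap-parity (suc y) ey))) ⟩
        perp (par (y + z))   ≡⟨ sym (par-odd+ {m} (y + z) odd-m) ⟩
        par (m + (y + z))    ≡⟨ cong par (trans (cong (λ u → m + u) (+-comm y z)) (sym (+-assoc m z y))) ⟩
        par (m + z + y)      ∎
        where open ≡-Reasoning

      parity-east : ∀ x → perp (par x) ≡ par (M + x + m)
      parity-east x = begin
        perp (par x)         ≡⟨ sym (par-odd+ {m} x odd-m) ⟩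
        par (m + x)          ≡⟨ sym (M+-parity (m + x)) ⟩
        par (M + (m + x))    ≡⟨ cong par (trans (cong (λ u → M + u) (+-comm m x)) (sym (+-assoc M x m))) ⟩
        par (M + x + m)      ∎
        where open ≡-Reasoning

      parity-NE : ∀ x y → par (x + y) ≡ par (M + x + (M + y))
      parity-NE x y = begin
        par (x + y)          ≡⟨ sym (M+-parity (x + y)) ⟩
        par (M + (x + y))    ≡⟨ sym (M+-parity (M + (x + y))) ⟩
        par (M + (M + (x + y)))
          ≡⟨ cong par (trans (cong (λ u → M + u) (x∙yz≈y∙xz M x y)) (sym (+-assoc M x (M + y)))) ⟩
        par (M + x + (M + y)) ∎
        where open ≡-Reasoning

    grow-local : ∀ x y → x < m + M → y < M′ → Local (par (x + y)) g x y (g (suc x) (suc y))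
    grow-local x y x< y< with region m (suc x) (suc y)
    ... | SW x<M y≤M = grow-local-SW x y x<M y≤M
    ... | NW x′ y′ ex ey with suc-injective (trans ey (+-suc M y′))
    ...   | refl = subst (λ o → Local o g x (M + y′) (g (suc x) (suc (M + y′)))) (parity-NW x x′ y′ ex)
                     (grow-local-NW _ x x′ y′ ex (+-cancelˡ-< M y′ M y<) refl)
    grow-local x y x< y< | SE x′ z ey ex with suc-injective ex
    ...   | refl = subst (λ o → Local o g (m + z) y (g (suc (m + z)) (suc y))) (parity-SE y x′ z ey)
                     (grow-local-SE _ y x′ z ey (+-cancelˡ-< m z M x<) refl)
    grow-local x y x< y< | NE zero zero ex ey
      with suc-injective (trans ex (+-identityʳ M)) | suc-injective (trans ey (+-identityʳ M))
    ... | refl | refl rewrite par-m+m = grow-local-corner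
    grow-local x y x< y< | NE zero (suc y′) ex ey
      with suc-injective (trans ex (+-identityʳ M)) | suc-injective (trans ey (+-suc M y′))
    ... | refl | refl = subst (λ o → Local o g m (M + y′) (g M (suc (M + y′)))) (sym (trans (par-odd+ {m} (M + y′) odd-m) (cong perp (M+-parity y′))))
                     (grow-local-north _ y′ refl)
    grow-local x y x< y< | NE (suc x′) zero ex ey
      with suc-injective (trans ex (+-suc M x′)) | suc-injective (trans ey (+-identityʳ M))
    ... | refl | refl = subst (λ o → Local o g (M + x′) m (g (suc (M + x′)) M)) (parity-east x′)
                     (grow-local-east _ x′ (+-cancelˡ-< M x′ m (subst (M + x′ <_) m+M≡M+m x<)) refl)
    grow-local x y x< y< | NE (suc x′) (suc y′) ex ey
      with suc-injective (trans ex (+-suc M x′)) | suc-injective (trans ey (+-suc M y′))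
    ... | refl | refl = subst (λ o → Local o g (M + x′) (M + y′) (g (suc (M + x′)) (suc (M + y′)))) (parity-NE x′ y′)
                     (grow-local-NE _ x′ y′ (+-cancelˡ-< M x′ m (subst (M + x′ <_) m+M≡M+m x<)) (+-cancelˡ-< M y′ M y<) refl)

    grow-ages : Ages (m + M) g
    grow-ages = record
      { even-M = even-M′
      ; f00 = grow-00 ; f01 = grow-01 ; f0y = grow-0y ; fx0 = grow-x0
      ; right0 = grow-right0 ; top0 = grow-top0 ; bound = grow-bound ; inner = grow-inner
      ; col-odd = grow-col-odd ; col-even = grow-col-even
      ; row-odd = grow-row-odd ; row-even = grow-row-even
      ; anti = grow-anti ; local = grow-local
      }

-- The exponent is shifted: suc (pred2^ k) ≡ 2 ^ suc k.
pred2^ : ℕ → ℕ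
pred2^ zero    = 1
pred2^ (suc k) = pred2^ k + suc (pred2^ k)

-- Starts from the four stages that fill the block for `M` = 2, the smallest even value.
age : ℕ → ℕ → ℕ → ℕ
age zero 0 0 = 1
age zero 0 1 = 2
age zero 1 1 = 3
age zero 1 2 = 4
age zero _ _ = 0
age (suc k) = grow (pred2^ k) (age k)

ages-base : Ages 1 (age 0)
ages-base = record
  { even-M = refl ; f00 = refl ; f01 = refl ; f0y = λ _ → refl
  ; fx0 = λ { zero → refl ; (suc x) → refl }
  ; right0 = λ { {suc (suc x)} y (s≤s (s≤s _)) → refl }
  ; top0 = λ { 0 {suc (suc (suc y))} _ → refl ; 1 {suc (suc (suc y))} _ → refl ; (suc (suc x)) {suc (suc (suc y))} _ → refl
             ; _ {1} (s≤s ()) ; _ {2} (s≤s (s≤s ())) }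
  ; bound = λ { 0 0 → s≤s z≤n ; 0 1 → s≤s (s≤s z≤n) ; 0 (suc (suc y)) → z≤n ; 1 0 → z≤n ; 1 1 → s≤s (s≤s (s≤s z≤n))
              ; 1 2 → ≤-refl ; 1 (suc (suc (suc y))) → z≤n ; (suc (suc x)) y → z≤n }
  ; inner = λ { 0 0 → inj₂ ≤-refl ; 0 1 → inj₂ (n≤1+n 3) ; 0 (suc (suc y)) → inj₁ refl ; (suc x) y → inj₁ refl }
  ; col-odd = λ { {1} _ _ → refl ; {suc (suc y)} (s≤s (s≤s ())) _ }
  ; col-even = λ { {0} _ _ → refl ; {suc (suc y)} (s≤s (s≤s ())) _ }
  ; row-odd = λ { {1} _ _ → refl ; {suc (suc y)} (s≤s (s≤s ())) _ }
  ; row-even = λ { {0} _ _ → refl ; {suc (suc y)} (s≤s (s≤s ())) _ }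
  ; anti = λ { {1} _ _ → refl ; {suc (suc y)} (s≤s (s≤s ())) _ }
  ; local = λ { 0 0 _ _ → left (s≤s z≤n , inj₁ refl) refl ; 0 1 _ _ → left (s≤s z≤n , inj₁ refl) refl
              ; 0 (suc (suc y)) _ (s≤s (s≤s ())) ; (suc x) y (s≤s ()) _ }
  }

ages : ∀ k → Ages (pred2^ k) (age k)
ages zero    = ages-base
ages (suc k) = Grow.grow-ages (pred2^ k) (age k) (ages k)

module _ {m f} (A : Ages m f) where
  open Ages A

  private
    odd-m : par m ≡ horizontal
    odd-m = perp-injective even-M

  -- The age following M + M is cut off; it only occurs at (M , M).
  LocalOrCut : Orientation → ℕ → ℕ → Set
  LocalOrCut o x y = Local o f x y (f (suc x) (suc y)) ⊎
                     (f (suc x) (suc y) ≡ 0 × Local o f x y (suc (M + M)))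

  private
    outside-right : ∀ o x y → M ≤ x → Local o f x y (f (suc x) (suc y))
    outside-right vertical   x y le = tie (trans (right0 _ le) (sym (right0 _ (m≤n⇒m≤o+n 2 le)))) (right0 _ (m≤n⇒m≤1+n le))
    outside-right horizontal x y le = tie (trans (right0 _ (m≤n⇒m≤1+n le)) (sym (right0 _ (m≤n⇒m≤1+n le)))) (right0 _ (m≤n⇒m≤1+n le))

    edge-right : ∀ o y → par (m + y) ≡ o → LocalOrCut o m y
    edge-right horizontal y p = inj₁ (tie (trans (right0 _ ≤-refl) (sym (right0 _ ≤-refl))) (right0 _ ≤-refl))
    edge-right vertical y p with <-cmp (suc y) M
    ... | tri< lt _ _ = inj₁ (tie (trans (col-even lt even-1+y) (sym (right0 _ (n≤1+n M)))) (right0 _ ≤-refl))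
      where even-1+y = trans (sym (par-odd+ {m} y odd-m)) p
    ... | tri≈ _ refl _ = inj₂ (right0 _ ≤-refl ,
            subst₂ (λ u v → Rule u v (suc (M + M))) (sym (row-odd ≤-refl odd-m)) (sym (right0 M (n≤1+n M)))
              (left (s≤s z≤n , inj₁ refl) refl))
    ... | tri> _ _ gt = inj₁ (tie (trans (top0 _ gt) (sym (top0 _ gt))) (top0 _ gt))

    outside-top : ∀ o x y → suc x < M → M ≤ y → par (x + y) ≡ o → Local o f x y (f (suc x) (suc y))
    outside-top vertical   x y lt le p = tie (trans (top0 _ (s≤s le)) (sym (top0 _ (s≤s le)))) (top0 _ (s≤s le))
    outside-top horizontal x y lt le p with m≤n⇒m<n∨m≡n le
    ... | inj₁ M<y  = tie (trans (top0 _ M<y) (sym (top0 _ (m≤n⇒m≤o+n 2 M<y)))) (top0 _ (m≤n⇒m≤1+n M<y))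
    ... | inj₂ refl = tie (trans (row-even lt (cong perp odd-x)) (sym (top0 _ (m≤n⇒m≤1+n ≤-refl)))) (top0 _ ≤-refl)
      where
      odd-x : par x ≡ horizontal
      odd-x = trans (sym (par-even+ {M} x even-M)) (trans (cong par (+-comm M x)) p)

  -- Outside the block all ages vanish. By parity, the parents of a point just outside are empty as
  -- well, being even border points or lying outside too, save that `(M , M)` has the parent
  -- `(m , M)`.
  local-or-cut : ∀ x y → LocalOrCut (par (x + y)) x y
  local-or-cut x y with <-cmp (suc x) M
  ... | tri> _ _ gt   = inj₁ (outside-right _ x y (s≤s⁻¹ gt))
  ... | tri≈ _ refl _ = edge-right _ y refl
  ... | tri< lt _ _ with y <? M
  ...   | yes y<M = inj₁ (local x y (s≤s⁻¹ lt) y<M)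
  ...   | no  y≮M = inj₁ (outside-top _ x y lt (≮⇒≥ y≮M) refl)

-- The structure as a set of points

module _ {a p} {A : Set a} {P : Pred A p} (P? : Decidable P) where

  filter-single⇒≡ : ∀ {xs x y} → length (filter P? xs) ≡ 1 →
                    x ∈ xs → P x → y ∈ xs → P y → x ≡ y
  filter-single⇒≡ {xs} one x∈ px y∈ py
    with filter P? xs | one | ∈-filter⁺ P? x∈ px | ∈-filter⁺ P? y∈ py
  ... | _ ∷ [] | _ | here refl | here refl = refl

  ≡⇒filter-single : ∀ {xs x} → Unique xs → x ∈ xs → P x →
                    (∀ {y} → y ∈ xs → P y → y ≡ x) → length (filter P? xs) ≡ 1
  ≡⇒filter-single {xs} {x} uniq x∈ px only =
    single (Unique.filter⁺ P? uniq) (∈-filter⁺ P? x∈ px)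
           λ y∈ → let y∈xs , py = ∈-filter⁻ P? {xs = xs} y∈ in only y∈xs py
    where
    single : ∀ {ys} → Unique ys → x ∈ ys → (∀ {y} → y ∈ ys → y ≡ x) → length ys ≡ 1
    single {_ ∷ []}    _              _ _    = refl
    single {_ ∷ _ ∷ _} ((≢ ∷ _) ∷ _) _ all≡ =
      contradiction (trans (all≡ (here refl)) (sym (all≡ (there (here refl))))) ≢

concatMap-unique : ∀ {a b} {A : Set a} {B : Set b} (h : A → List B) {xs} → Unique xs →
                   (∀ {x} → x ∈ xs → Unique (h x)) →
                   (∀ {x y z} → x ∈ xs → y ∈ xs → z ∈ h x → z ∈ h y → x ≡ y) →
                   Unique (concatMap h xs)
concatMap-unique h {[]} _ _ _ = []
concatMap-unique h {x ∷ xs} (x∉ ∷ uniq) each apart =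
  Unique.++⁺ (each (here refl))
    (concatMap-unique h uniq (λ x∈ → each (there x∈)) (λ x∈ y∈ → apart (there x∈) (there y∈)))
    λ { (z∈x , z∈xs) → let y , y∈ , z∈y = find (∈-concatMap⁻ h {xs = xs} z∈xs) in
        All.lookup x∉ y∈ (apart (here refl) (there y∈) z∈x z∈y) }

-- Parity, reflection and parents in the plane

oriAt : Point → Orientation
oriAt (x , y) = par (∣ x ∣ + ∣ y ∣)

site : Point → Toothpick
site p = tp p (oriAt p)

origin : Point
origin = + 0 , + 0

-- The sign of `x` decides which neighbour is nearer to the axis. Since the birth rule is symmetric
-- in the parents, either order will do.
abs-step : ∀ x {a} → ∣ x ∣ ≡ suc a →
           (∣ x ℤ.+ + 1 ∣ ≡ 2 + a × ∣ x ℤ.- + 1 ∣ ≡ a) ⊎ (∣ x ℤ.+ + 1 ∣ ≡ a × ∣ x ℤ.- + 1 ∣ ≡ 2 + a)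
abs-step (+ suc a)       refl = inj₁ (cong suc (+-comm a 1) , refl)
abs-step -[1+ zero ]     refl = inj₂ (refl , refl)
abs-step -[1+ suc a ]    refl = inj₂ (refl , cong (λ u → suc (suc u)) (cong suc (+-identityʳ a)))

abs-zero : ∀ x → ∣ x ∣ ≡ 0 → x ≡ + 0
abs-zero x = ℤₚ.∣i∣≡0⇒i≡0

par-abs₁ : ∀ x → par ∣ x ℤ.+ + 1 ∣ ≡ perp (par ∣ x ∣)
par-abs₁ (+ n) = cong par (+-comm n 1)
par-abs₁ -[1+ zero ] = refl
par-abs₁ -[1+ suc n ] = sym (perp² (perp (par n)))

par-abs₂ : ∀ x → par ∣ x ℤ.- + 1 ∣ ≡ perp (par ∣ x ∣)
par-abs₂ (+ zero) = refl
par-abs₂ (+ suc n) = sym (perp² (par n))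
par-abs₂ -[1+ n ] = cong par (cong (λ u → suc (suc u)) (+-identityʳ n))

par-perp+ : ∀ m n k → par m ≡ perp (par n) → par (m + k) ≡ perp (par (n + k))
par-perp+ m n k e = par-+-congˡ {m} {suc n} k e

oriAt-end₁ : ∀ T → oriAt (end₁ T) ≡ perp (oriAt (mid T))
oriAt-end₁ (tp (x , y) horizontal) = par-perp+ (∣ x ℤ.+ + 1 ∣) (∣ x ∣) (∣ y ∣) (par-abs₁ x)
oriAt-end₁ (tp (x , y) vertical)   =
  trans (cong par (+-comm ∣ x ∣ _)) (trans (par-perp+ (∣ y ℤ.+ + 1 ∣) (∣ y ∣) (∣ x ∣) (par-abs₁ y)) (cong (λ u → perp (par u)) (+-comm ∣ y ∣ ∣ x ∣)))

oriAt-end₂ : ∀ T → oriAt (end₂ T) ≡ perp (oriAt (mid T))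
oriAt-end₂ (tp (x , y) horizontal) = par-perp+ (∣ x ℤ.- + 1 ∣) (∣ x ∣) (∣ y ∣) (par-abs₂ x)
oriAt-end₂ (tp (x , y) vertical)   =
  trans (cong par (+-comm ∣ x ∣ _)) (trans (par-perp+ (∣ y ℤ.- + 1 ∣) (∣ y ∣) (∣ x ∣) (par-abs₂ y)) (cong (λ u → perp (par u)) (+-comm ∣ y ∣ ∣ x ∣)))

private
  x+1-1 : ∀ x → x ℤ.+ + 1 ℤ.- + 1 ≡ x
  x+1-1 x = trans (ℤₚ.+-assoc x (+ 1) (ℤ.- + 1)) (ℤₚ.+-identityʳ x)

  x-1+1 : ∀ x → x ℤ.- + 1 ℤ.+ + 1 ≡ x
  x-1+1 x = trans (ℤₚ.+-assoc x (ℤ.- + 1) (+ 1)) (ℤₚ.+-identityʳ x)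

end₂∘end₁ : ∀ p o → end₂ (tp (end₁ (tp p o)) o) ≡ p
end₂∘end₁ (x , y) vertical   = cong (x ,_) (x+1-1 y)
end₂∘end₁ (x , y) horizontal = cong (_, y) (x+1-1 x)

end₁∘end₂ : ∀ p o → end₁ (tp (end₂ (tp p o)) o) ≡ p
end₁∘end₂ (x , y) vertical   = cong (x ,_) (x-1+1 y)
end₁∘end₂ (x , y) horizontal = cong (_, y) (x-1+1 x)

end₁≢end₂ : ∀ T → end₁ T ≢ end₂ T
end₁≢end₂ (tp (x , y) vertical)   e with ℤ-cancelˡ y _ _ (cong proj₂ e)
... | ()
end₁≢end₂ (tp (x , y) horizontal) e with ℤ-cancelˡ x _ _ (cong proj₁ e)
... | ()

perp≢ : ∀ {o} → perp o ≢ o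
perp≢ {vertical} ()
perp≢ {horizontal} ()

-- The midpoint of a toothpick with end₁ at p is the end₂ of the same toothpick moved to p.
parent₁ parent₂ : Point → Point
parent₁ p = end₂ (tp p (perp (oriAt p)))
parent₂ p = end₁ (tp p (perp (oriAt p)))

oriAt-parent₁ : ∀ p → oriAt (parent₁ p) ≡ perp (oriAt p)
oriAt-parent₁ p = oriAt-end₂ (tp p (perp (oriAt p)))

oriAt-parent₂ : ∀ p → oriAt (parent₂ p) ≡ perp (oriAt p)
oriAt-parent₂ p = oriAt-end₁ (tp p (perp (oriAt p)))

end₁-parent₁ : ∀ p → p ≡ end₁ (site (parent₁ p))
end₁-parent₁ p rewrite oriAt-parent₁ p = sym (end₁∘end₂ p _)

end₂-parent₂ : ∀ p → p ≡ end₂ (site (parent₂ p))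
end₂-parent₂ p rewrite oriAt-parent₂ p = sym (end₂∘end₁ p _)

parent₁-end₁ : ∀ q → parent₁ (end₁ (site q)) ≡ q
parent₁-end₁ q rewrite oriAt-end₁ (site q) | perp² (oriAt q) = end₂∘end₁ q _

parent₂-end₂ : ∀ q → parent₂ (end₂ (site q)) ≡ q
parent₂-end₂ q rewrite oriAt-end₂ (site q) | perp² (oriAt q) = end₁∘end₂ q _

IsSite : Toothpick → Set
IsSite T = T ≡ site (mid T)

module Growth {m f} (A : Ages m f) where
  open Ages A

  -- Absolute values extend the ages to the plane, using the symmetry of the structure in both axes.
  F : Point → ℕ
  F (x , y) = f ∣ x ∣ ∣ y ∣

  RuleOrCut : (a b c : ℕ) → Set
  RuleOrCut a b c = Rule a b c ⊎ (c ≡ 0 × Rule a b (suc (M + M)))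

  RuleOrCut-swap : ∀ {a b c} → RuleOrCut a b c → RuleOrCut b a c
  RuleOrCut-swap (inj₁ r)       = inj₁ (rule-swap r)
  RuleOrCut-swap (inj₂ (z , r)) = inj₂ (z , rule-swap r)

  origin-1 : ∀ p → F p ≡ 1 → p ≡ origin
  origin-1 (x , y) e with ∣ x ∣ in ex | ∣ y ∣ in ey
  ... | 0 | 0           = cong₂ _,_ (abs-zero x ex) (abs-zero y ey)
  ... | 0 | 1           = contradiction (trans (sym f01) e) λ ()
  ... | 0 | suc (suc b) = contradiction (trans (sym (f0y b)) e) λ ()
  ... | suc a | 0       = contradiction (trans (sym (fx0 a)) e) λ ()
  ... | suc a | suc b with inner a b
  ...   | inj₁ z = contradiction (trans (sym z) e) λ ()
  ...   | inj₂ l = contradiction (subst (3 ≤_) e l) λ { (s≤s ()) }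

  private
    vertical-law : ∀ a b → par (suc a + b) ≡ vertical →
                   RuleOrCut (f a b) (f (2 + a) b) (f (suc a) b)
    vertical-law zero    zero    ()
    vertical-law (suc a) zero    _ = inj₁ (tie (trans (fx0 a) (sym (fx0 (2 + a)))) (fx0 (suc a)))
    vertical-law a       (suc b) p = subst (λ o → LocalOrCut A o a b)
      (perp-injective {_} {vertical} (trans (sym (cong par (+-suc a b))) (perp-injective {_} {horizontal} p))) (local-or-cut A a b)

    horizontal-law : ∀ a b → par (a + suc b) ≡ horizontal →
                     RuleOrCut (f a b) (f a (2 + b)) (f a (suc b))
    horizontal-law zero zero _          = inj₁ (left (subst (1 ≤_) (sym f00) ≤-refl , inj₁ (f0y 0)) (trans f01 (cong suc (sym f00))))
    horizontal-law zero (suc zero) ()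
    horizontal-law zero (suc (suc b)) _ = inj₁ (tie (trans (f0y b) (sym (f0y (2 + b)))) (f0y (suc b)))
    horizontal-law (suc a) b p = subst (λ o → LocalOrCut A o a b)
      (perp-injective {_} {horizontal} (trans (sym (cong par (+-suc a b))) (perp-injective {_} {vertical} p))) (local-or-cut A a b)

  -- Two parents on opposite sides of an axis are mirror images and tie; away from the axes
  -- reflection reduces to the first quadrant. The initial toothpick has no parent, so the origin is
  -- excluded.
  law : ∀ p → p ≢ origin → RuleOrCut (F (parent₁ p)) (F (parent₂ p)) (F p)
  law (x , y) p≢0 with par (∣ x ∣ + ∣ y ∣) in po
  ... | vertical with ∣ x ∣ in ex
  ...   | zero  = inj₁ (tie (cong (λ u → f u ∣ y ∣) abs≡) (even-axis ∣ y ∣ refl po))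
    where
    abs≡ : ∣ x ℤ.- + 1 ∣ ≡ ∣ x ℤ.+ + 1 ∣
    abs≡ rewrite abs-zero x ex = refl
    even-axis : ∀ b → ∣ y ∣ ≡ b → par b ≡ vertical → f 0 b ≡ 0
    even-axis zero          ey _ = contradiction (cong₂ _,_ (abs-zero x ex) (abs-zero y ey)) p≢0
    even-axis (suc (suc b)) _  _ = f0y b
  ...   | suc a with abs-step x ex
  ...     | inj₁ (e₁ , e₂) rewrite e₁ | e₂ = vertical-law a ∣ y ∣ po
  ...     | inj₂ (e₁ , e₂) rewrite e₁ | e₂ = RuleOrCut-swap (vertical-law a ∣ y ∣ po)
  law (x , y) p≢0 | horizontal with ∣ y ∣ in ey
  ...   | zero  = inj₁ (tie (cong (f ∣ x ∣) abs≡) (odd-axis ∣ x ∣ po))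
    where
    abs≡ : ∣ y ℤ.- + 1 ∣ ≡ ∣ y ℤ.+ + 1 ∣
    abs≡ rewrite abs-zero y ey = refl
    odd-axis : ∀ a → par (a + 0) ≡ horizontal → f a 0 ≡ 0
    odd-axis (suc a) _ = fx0 a
  ...   | suc b with abs-step y ey
  ...     | inj₁ (e₁ , e₂) rewrite e₁ | e₂ = horizontal-law ∣ x ∣ b po
  ...     | inj₂ (e₁ , e₂) rewrite e₁ | e₂ = RuleOrCut-swap (horizontal-law ∣ x ∣ b po)

  On : ℕ → Toothpick → Set
  On n T = IsSite T × 1 ≤ F (mid T) × F (mid T) ≤ n

  Off : ℕ → ℕ → Set
  Off n c = c ≡ 0 ⊎ n < c

  off : ∀ {n c} → ¬ (1 ≤ c × c ≤ n) → Off n c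
  off {n} {zero}  _ = inj₁ refl
  off {n} {suc c} h = inj₂ (≰⇒> λ le → h (s≤s z≤n , le))

  off⇒¬on : ∀ {n c} → Off n c → 1 ≤ c → c ≤ n → ∀ {w} {W : Set w} → W
  off⇒¬on (inj₁ refl) ()
  off⇒¬on (inj₂ n<c) _ c≤n = contradiction c≤n (<⇒≱ n<c)

  -- Had the present parent been born before stage `n`, its child would be in place already; so its
  -- age is `n`. The cut age would need a parent of age `M + M`, which exceeds `n`.
  born : ∀ {n a b c} → RuleOrCut a b c → n < M + M → 1 ≤ a → a ≤ n → Off n b → Off n c → c ≡ suc n
  born (inj₁ (tie refl _)) _ 1≤a a≤n offb _ = off⇒¬on offb 1≤a a≤n
  born (inj₁ (left _ refl)) _ _ a≤n _ (inj₂ n<c) = cong suc (≤-antisym a≤n (s≤s⁻¹ n<c))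
  born (inj₁ (right (1≤b , inj₁ refl) _)) _ () _ _ _
  born (inj₁ (right (1≤b , inj₂ b<a) _)) _ _ a≤n offb _ = off⇒¬on offb 1≤b (<⇒≤ (<-≤-trans b<a a≤n))
  born (inj₂ (_ , tie refl ())) 
  born (inj₂ (_ , left _ refl)) n<2M _ a≤n _ _ = contradiction a≤n (<⇒≱ n<2M)
  born (inj₂ (_ , right (1≤b , inj₁ refl) _)) _ () _ _ _
  born (inj₂ (_ , right (1≤b , inj₂ b<a) _)) _ _ a≤n offb _ = off⇒¬on offb 1≤b (<⇒≤ (<-≤-trans b<a a≤n))

  module Stage (n : ℕ) (n≥1 : 1 ≤ n) (n<2M : n < M + M) (S : List Toothpick) (uniq : Unique S)
               (on⇒∈ : ∀ {T} → On n T → T ∈ S) (∈⇒on : ∀ {T} → T ∈ S → On n T) where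

    ∈-newAt⁻ : ∀ {T T′} → T′ ∈ newAt S T →
               ∃[ p ] (p ≡ end₁ T ⊎ p ≡ end₂ T) × incidence S p ≡ 1 × T′ ≡ tp p (perp (ori T))
    ∈-newAt⁻ {T} T′∈ with ∈-map⁻ _ T′∈
    ... | p , p∈ , e with ∈-filter⁻ (exposed? S) {xs = end₁ T ∷ end₂ T ∷ []} p∈
    ...   | here q         , one = p , inj₁ q , one , e
    ...   | there (here q) , one = p , inj₂ q , one , e

    ∈-newAt⁺ : ∀ {T p} → (p ≡ end₁ T ⊎ p ≡ end₂ T) → incidence S p ≡ 1 →
               tp p (perp (ori T)) ∈ newAt S T
    ∈-newAt⁺ (inj₁ e) one = ∈-map⁺ _ (∈-filter⁺ (exposed? S) (here e) one)
    ∈-newAt⁺ (inj₂ e) one = ∈-map⁺ _ (∈-filter⁺ (exposed? S) (there (here e)) one)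

    -- An exposed end belongs to a single toothpick, so no new toothpick is placed twice. Thus the
    -- length counted by `t` is a number of points.
    added-unique : Unique (added S)
    added-unique = concatMap-unique (newAt S) uniq
      (λ {T} _ → Unique.map⁺ (cong mid) (Unique.filter⁺ (exposed? S) ((end₁≢end₂ T ∷ []) ∷ ([] ∷ []))))
      same
      where
      same : ∀ {T U V} → T ∈ S → U ∈ S → V ∈ newAt S T → V ∈ newAt S U → T ≡ U
      same T∈ U∈ V∈T V∈U with ∈-newAt⁻ V∈T | ∈-newAt⁻ V∈U
      ... | p , pT , one , e | _ , pU , _ , e′ with cong mid (trans (sym e) e′)
      ...   | refl =
        filter-single⇒≡ (touches? p) one T∈ (inj₁ pT) U∈ (inj₁ pU)

    module _ {p} (one : incidence S p ≡ 1) where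

      -- A toothpick centred at `p` would be a second one touching `p`: an end and the midpoint of a
      -- toothpick differ in parity.
      site-off : ∀ {T} → T ∈ S → (p ≡ end₁ T ⊎ p ≡ end₂ T) → Off n (F p)
      site-off {T} T∈ pT = off λ { (1≤ , ≤n) → mid≢ pT
        (cong mid (filter-single⇒≡ (touches? p) one (on⇒∈ {site p} (refl , 1≤ , ≤n)) (inj₂ refl) T∈ (inj₁ pT))) }
        where
        mid≢ : (p ≡ end₁ T ⊎ p ≡ end₂ T) → p ≢ mid T
        mid≢ (inj₁ refl) e = perp≢ (trans (sym (oriAt-end₁ T)) (cong oriAt e))
        mid≢ (inj₂ refl) e = perp≢ (trans (sym (oriAt-end₂ T)) (cong oriAt e))

      other-off : ∀ {T q} → T ∈ S → (p ≡ end₁ T ⊎ p ≡ end₂ T) →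
                  (p ≡ end₁ (site q) ⊎ p ≡ end₂ (site q)) → mid T ≢ q → Off n (F q)
      other-off T∈ pT pq mid≢ = off λ { (1≤ , ≤n) → mid≢
        (cong mid (filter-single⇒≡ (touches? p) one T∈ (inj₁ pT) (on⇒∈ (refl , 1≤ , ≤n)) (inj₁ pq))) }

      ≢origin : Off n (F p) → p ≢ origin
      ≢origin o refl = off⇒¬on o (≤-reflexive (sym f00)) (≤-trans (≤-reflexive f00) n≥1)

      parents≢ : parent₁ p ≢ parent₂ p
      parents≢ e = end₁≢end₂ (tp p _) (sym e)

      exposed⇒born : ∀ {T} → T ∈ S → (p ≡ end₁ T ⊎ p ≡ end₂ T) → F p ≡ suc n × oriAt p ≡ perp (ori T)
      exposed⇒born {T} T∈ pT with ∈⇒on T∈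
      exposed⇒born {T} T∈ (inj₁ refl) | isT , 1≤ , ≤n =
        born (law p (≢origin offp)) n<2M (subst (λ q → 1 ≤ F q) (sym par≡) 1≤) (subst (λ q → F q ≤ n) (sym par≡) ≤n)
          (other-off T∈ (inj₁ refl) (inj₂ (end₂-parent₂ p)) λ e → parents≢ (trans par≡ e)) offp ,
        trans (oriAt-end₁ T) (cong perp (sym (cong ori isT)))
        where
        offp : Off n (F p)
        offp = site-off T∈ (inj₁ refl)
        par≡ : parent₁ p ≡ mid T
        par≡ = trans (cong (λ U → parent₁ (end₁ U)) isT) (parent₁-end₁ (mid T))
      exposed⇒born {T} T∈ (inj₂ refl) | isT , 1≤ , ≤n =
        born (RuleOrCut-swap (law p (≢origin offp))) n<2M (subst (λ q → 1 ≤ F q) (sym par≡) 1≤) (subst (λ q → F q ≤ n) (sym par≡) ≤n)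
          (other-off T∈ (inj₂ refl) (inj₁ (end₁-parent₁ p)) λ e → parents≢ (sym (trans par≡ e))) offp ,
        trans (oriAt-end₂ T) (cong perp (sym (cong ori isT)))
        where
        offp : Off n (F p)
        offp = site-off T∈ (inj₂ refl)
        par≡ : parent₂ p ≡ mid T
        par≡ = trans (cong (λ U → parent₂ (end₂ U)) isT) (parent₂-end₂ (mid T))

    New : Toothpick → Set
    New T = IsSite T × F (mid T) ≡ suc n

    added⇒new : ∀ {T} → T ∈ added S → New T
    added⇒new T∈ with find (∈-concatMap⁻ (newAt S) {xs = S} T∈)
    ... | U , U∈ , T∈U with ∈-newAt⁻ T∈U
    ...   | p , pU , one , refl with exposed⇒born one U∈ pU
    ...     | age≡ , ori≡ = cong (tp p) (sym ori≡) , age≡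

    born-left : ∀ {p} → F p ≡ suc n → (T : Toothpick) → T ∈ S → perp (ori T) ≡ oriAt p →
                (p ≡ end₁ T ⊎ p ≡ end₂ T) →
                (∀ {U} → U ∈ S → (p ≡ end₁ U ⊎ p ≡ end₂ U) → U ≡ T) → site p ∈ added S
    born-left {p} age≡ T T∈ ori≡ pT only =
      ∈-concatMap⁺ (newAt S) (lose T∈ (subst (λ o → tp p o ∈ newAt S T) ori≡
        (∈-newAt⁺ pT (≡⇒filter-single (touches? p) uniq T∈ (inj₁ pT) only′))))
      where
      only′ : ∀ {U} → U ∈ S → ((p ≡ end₁ U ⊎ p ≡ end₂ U) ⊎ p ≡ mid U) → U ≡ T
      only′ U∈ (inj₁ pU)   = only U∈ pU
      only′ U∈ (inj₂ refl) = contradiction (≤-trans (≤-reflexive (sym age≡)) (proj₂ (proj₂ (∈⇒on U∈)))) (<-irrefl refl)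

    private
      at-end₁ : ∀ {U p} → IsSite U → p ≡ end₁ U → mid U ≡ parent₁ p
      at-end₁ {U} isU refl = sym (trans (cong (λ V → parent₁ (end₁ V)) isU) (parent₁-end₁ (mid U)))

      at-end₂ : ∀ {U p} → IsSite U → p ≡ end₂ U → mid U ≡ parent₂ p
      at-end₂ {U} isU refl = sym (trans (cong (λ V → parent₂ (end₂ V)) isU) (parent₂-end₂ (mid U)))

      sooner-off : ∀ {a b} → Sooner a b → a ≡ n → Off n b
      sooner-off (_ , inj₁ e) _    = inj₁ e
      sooner-off (_ , inj₂ l) refl = inj₂ l

      -- A positive age comes from one strictly older parent, here of age `n`. The other parent is
      -- absent at stage `n`, so only one toothpick of `S` touches `p` and its end there is exposed.
      born∈ : ∀ p → F p ≡ suc n → site p ∈ added S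
      born∈ p age≡ with law p (λ { refl → <⇒≢ (s≤s n≥1) (trans (sym f00) age≡) })
      ... | inj₂ (z , _)         = contradiction (trans (sym z) age≡) λ ()
      ... | inj₁ (tie _ z)       = contradiction (trans (sym z) age≡) λ ()
      ... | inj₁ (left so e) = born-left age≡ (site (parent₁ p))
              (on⇒∈ (refl , proj₁ so , ≤-reflexive a≡n))
              (trans (cong perp (oriAt-parent₁ p)) (perp² _)) (inj₁ (end₁-parent₁ p)) only
        where
        a≡n : F (parent₁ p) ≡ n
        a≡n = suc-injective (trans (sym e) age≡)
        only : ∀ {U} → U ∈ S → (p ≡ end₁ U ⊎ p ≡ end₂ U) → U ≡ site (parent₁ p)
        only U∈ (inj₁ pU) = let isU , _ = ∈⇒on U∈ in trans isU (cong site (at-end₁ isU pU))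
        only U∈ (inj₂ pU) = let isU , 1≤ , ≤n = ∈⇒on U∈ ; q≡ = at-end₂ isU pU in
          off⇒¬on (sooner-off so a≡n) (subst (λ q → 1 ≤ F q) q≡ 1≤) (subst (λ q → F q ≤ n) q≡ ≤n)
      ... | inj₁ (right so e) = born-left age≡ (site (parent₂ p))
              (on⇒∈ (refl , proj₁ so , ≤-reflexive a≡n))
              (trans (cong perp (oriAt-parent₂ p)) (perp² _)) (inj₂ (end₂-parent₂ p)) only
        where
        a≡n : F (parent₂ p) ≡ n
        a≡n = suc-injective (trans (sym e) age≡)
        only : ∀ {U} → U ∈ S → (p ≡ end₁ U ⊎ p ≡ end₂ U) → U ≡ site (parent₂ p)
        only U∈ (inj₂ pU) = let isU , _ = ∈⇒on U∈ in trans isU (cong site (at-end₂ isU pU))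
        only U∈ (inj₁ pU) = let isU , 1≤ , ≤n = ∈⇒on U∈ ; q≡ = at-end₁ isU pU in
          off⇒¬on (sooner-off so a≡n) (subst (λ q → 1 ≤ F q) q≡ 1≤) (subst (λ q → F q ≤ n) q≡ ≤n)

    new⇒added : ∀ {T} → New T → T ∈ added S
    new⇒added {T} (isT , age≡) = subst (_∈ added S) (sym isT) (born∈ (mid T) age≡)

  record Stages (n : ℕ) : Set where
    field
      unique : Unique (structure n)
      on⇒∈   : ∀ {T} → On n T → T ∈ structure n
      ∈⇒on   : ∀ {T} → T ∈ structure n → On n T

  stages : ∀ n → suc n ≤ M + M → Stages (suc n)
  stages zero _ = record
    { unique = [] ∷ []
    ; on⇒∈ = λ { {T} (isT , 1≤ , ≤1) → here (trans isT (cong site (origin-1 (mid T) (≤-antisym ≤1 1≤)))) }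
    ; ∈⇒on = λ { (here refl) → refl , ≤-reflexive (sym f00) , ≤-reflexive f00 }
    }
  stages (suc n) le = record
    { unique = Unique.++⁺ unique added-unique λ { (T∈ , T∈′) → 
        contradiction (≤-trans (≤-reflexive (sym (proj₂ (added⇒new T∈′)))) (proj₂ (proj₂ (∈⇒on T∈)))) (<-irrefl refl) }
    ; on⇒∈ = on⇒∈′
    ; ∈⇒on = ∈⇒on′
    }
    where
    open Stages (stages n (<⇒≤ le))
    open Stage (suc n) (s≤s z≤n) le (structure (suc n)) unique on⇒∈ ∈⇒on
    on⇒∈′ : ∀ {T} → On (2 + n) T → T ∈ structure (2 + n)
    on⇒∈′ (isT , 1≤ , ≤2+n) with m≤n⇒m<n∨m≡n ≤2+n
    ... | inj₁ <2+n = ∈-++⁺ˡ (on⇒∈ (isT , 1≤ , s≤s⁻¹ <2+n))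
    ... | inj₂ ≡2+n = ∈-++⁺ʳ (structure (suc n)) (new⇒added (isT , ≡2+n))
    ∈⇒on′ : ∀ {T} → T ∈ structure (2 + n) → On (2 + n) T
    ∈⇒on′ T∈ with ∈-++⁻ (structure (suc n)) T∈
    ... | inj₁ old = let isT , 1≤ , le = ∈⇒on old in isT , 1≤ , m≤n⇒m≤1+n le
    ... | inj₂ new = let isT , e = added⇒new new in isT , subst (1 ≤_) (sym e) (s≤s z≤n) , ≤-reflexive e

-- Counting

∑ : ℕ → (ℕ → ℕ) → ℕ
∑ k h = sum (applyUpTo h k)

∑-cong : ∀ k {h h′} → (∀ {i} → i < k → h i ≡ h′ i) → ∑ k h ≡ ∑ k h′
∑-cong zero    eq = refl
∑-cong (suc k) eq = cong₂ _+_ (eq (s≤s z≤n)) (∑-cong k (λ i<k → eq (s≤s i<k)))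

∑-zero : ∀ k {h} → (∀ {i} → i < k → h i ≡ 0) → ∑ k h ≡ 0
∑-zero zero    eq = refl
∑-zero (suc k) eq = cong₂ _+_ (eq (s≤s z≤n)) (∑-zero k (λ i<k → eq (s≤s i<k)))

∑-+ : ∀ k h h′ → ∑ k (λ i → h i + h′ i) ≡ ∑ k h + ∑ k h′
∑-+ zero    h h′ = refl
∑-+ (suc k) h h′ = trans (cong₂ _+_ refl (∑-+ k (h ∘ suc) (h′ ∘ suc))) (interchange (h 0) (h′ 0) _ _)

∑-split : ∀ k l h → ∑ (k + l) h ≡ ∑ k h + ∑ l (λ i → h (k + i))
∑-split zero    l h = refl
∑-split (suc k) l h = trans (cong (λ u → h 0 + u) (∑-split k l (h ∘ suc))) (sym (+-assoc (h 0) _ _))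

∑-last : ∀ k h → ∑ (suc k) h ≡ ∑ k h + h k
∑-last zero    h = +-comm (h 0) 0
∑-last (suc k) h = trans (cong (λ u → h 0 + u) (∑-last k (h ∘ suc))) (sym (+-assoc (h 0) _ _))

∑-reverse : ∀ k {h h′} → (∀ i j → i + suc j ≡ k → h i ≡ h′ j) → ∑ k h ≡ ∑ k h′
∑-reverse zero    eq = refl
∑-reverse (suc k) {h} {h′} eq = begin
  h 0 + ∑ k (h ∘ suc) ≡⟨ cong₂ _+_ (eq 0 k refl) (∑-reverse k (λ i j e → eq (suc i) j (cong suc e))) ⟩
  h′ k + ∑ k h′       ≡⟨ +-comm (h′ k) _ ⟩
  ∑ k h′ + h′ k       ≡⟨ sym (∑-last k h′) ⟩
  ∑ (suc k) h′        ∎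
  where open ≡-Reasoning

∑-swap : ∀ k l (h : ℕ → ℕ → ℕ) → ∑ k (λ i → ∑ l (h i)) ≡ ∑ l (λ j → ∑ k (λ i → h i j))
∑-swap zero    l h = sym (∑-zero l (λ _ → refl))
∑-swap (suc k) l h = trans (cong (λ u → ∑ l (h 0) + u) (∑-swap k l (h ∘ suc))) (sym (∑-+ l (h 0) _))

indicator : ∀ {p} {P : Set p} → Dec P → ℕ
indicator (yes _) = 1
indicator (no _)  = 0

indicator-no : ∀ {p} {P : Set p} (d : Dec P) → ¬ P → indicator d ≡ 0
indicator-no (yes p) ¬p = contradiction p ¬p
indicator-no (no _)  _  = refl

indicator-cong : ∀ {p q} {P : Set p} {Q : Set q} (d : Dec P) (e : Dec Q) →
                 (P → Q) → (Q → P) → indicator d ≡ indicator e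
indicator-cong (yes p) (yes q) to from = refl
indicator-cong (yes p) (no ¬q) to from = contradiction (to p) ¬q
indicator-cong (no ¬p) (yes q) to from = contradiction (from q) ¬p
indicator-cong (no ¬p) (no ¬q) to from = refl

hit : ℕ → ℕ → ℕ
hit n v = indicator (v ≟ n)

hit-≢ : ∀ {n v} → v ≢ n → hit n v ≡ 0
hit-≢ {n} {v} = indicator-no (v ≟ n)

-- With `i` positive, an empty point counts on neither side.
hit-sh : ∀ s {i} v → 1 ≤ i → hit (s + i) (sh s v) ≡ hit i v
hit-sh s {i} zero    1≤i = trans (hit-≢ (<⇒≢ (m≤n⇒m≤o+n s 1≤i))) (sym (hit-≢ (<⇒≢ 1≤i)))
hit-sh s {i} (suc v) 1≤i = indicator-cong (s + suc v ≟ s + i) (suc v ≟ i) (+-cancelˡ-≡ s (suc v) i) (cong (λ u → s + u))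

length-filter-applyUpTo : ∀ {a p} {A : Set a} {P : Pred A p} (P? : Decidable P) (h : ℕ → A) k →
  length (filter P? (applyUpTo h k)) ≡ ∑ k (λ i → indicator (P? (h i)))
length-filter-applyUpTo P? h zero = refl
length-filter-applyUpTo P? h (suc k) with P? (h 0)
... | yes _ = cong suc (length-filter-applyUpTo P? (h ∘ suc) k)
... | no  _ = length-filter-applyUpTo P? (h ∘ suc) k

length-concatMap-applyUpTo : ∀ {a b} {A : Set a} {B : Set b} (g : A → List B) (h : ℕ → A) k →
  length (concatMap g (applyUpTo h k)) ≡ ∑ k (λ i → length (g (h i)))
length-concatMap-applyUpTo g h zero    = refl
length-concatMap-applyUpTo g h (suc k) =
  trans (length-++ (g (h 0))) (cong (λ u → length (g (h 0)) + u) (length-concatMap-applyUpTo g (h ∘ suc) k))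

length-concatMap-const : ∀ {a b} {A : Set a} {B : Set b} (g : A → List B) {c} →
  (∀ x → length (g x) ≡ c) → ∀ xs → length (concatMap g xs) ≡ length xs * c
length-concatMap-const g eq []       = refl
length-concatMap-const g eq (x ∷ xs) =
  trans (length-++ (g x)) (cong₂ _+_ (eq x) (length-concatMap-const g eq xs))

unique-length : ∀ {a} {A : Set a} {xs ys : List A} → Unique xs → Unique ys →
                (∀ {x} → x ∈ xs → x ∈ ys) → (∀ {x} → x ∈ ys → x ∈ xs) → length xs ≡ length ys
unique-length ux uy to from = ↭-length (∼bag⇒↭ (unique∧set⇒bag ux uy (mk⇔ to from)))

-- The toothpicks of age `n` in one open quadrant; by `right0` and `top0` none lies beyond this
-- range.
count : ℕ → (ℕ → ℕ → ℕ) → ℕ → ℕ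
count m f n = ∑ m λ a → ∑ (suc m) λ b → hit n (f (suc a) (suc b))

module _ {m f} (A : Ages m f) where
  open Ages A
  open Growth A

  module _ (n : ℕ) (3≤n : 3 ≤ n) where

    column : ℕ → List (ℕ × ℕ)
    column a = map (a ,_) (filter (λ b → f (suc a) (suc b) ≟ n) (upTo M))

    quadrant : List (ℕ × ℕ)
    quadrant = concatMap column (upTo m)

    length-quadrant : length quadrant ≡ count m f n
    length-quadrant = trans (length-concatMap-applyUpTo column (λ a → a) m)
      (∑-cong m λ {a} _ → trans (length-map _ (filter (λ b → f (suc a) (suc b) ≟ n) (upTo M)))
                                (length-filter-applyUpTo (λ b → f (suc a) (suc b) ≟ n) (λ b → b) M))

    ∈-column⁻ : ∀ {a q} → q ∈ column a → proj₁ q ≡ a × f (suc a) (suc (proj₂ q)) ≡ n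
    ∈-column⁻ {a} q∈ with ∈-map⁻ (a ,_) q∈
    ... | b , b∈ , refl = refl , proj₂ (∈-filter⁻ (λ b → f (suc a) (suc b) ≟ n) {xs = upTo M} b∈)

    ∈-quadrant⁻ : ∀ {q} → q ∈ quadrant → f (suc (proj₁ q)) (suc (proj₂ q)) ≡ n
    ∈-quadrant⁻ q∈ with find (∈-concatMap⁻ column {xs = upTo m} q∈)
    ... | a , _ , q∈a with ∈-column⁻ q∈a
    ...   | refl , e = e

    ∈-quadrant⁺ : ∀ {a b} → f (suc a) (suc b) ≡ n → (a , b) ∈ quadrant
    ∈-quadrant⁺ {a} {b} e with suc a ≤? m | b <? M
    ... | no  m≤a  | _ = contradiction (trans (sym (right0 _ (s≤s (≮⇒≥ m≤a)))) e) (<⇒≢ (≤-trans (s≤s z≤n) 3≤n))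
    ... | yes _    | no M≤b = contradiction (trans (sym (top0 _ (s≤s (≮⇒≥ M≤b)))) e) (<⇒≢ (≤-trans (s≤s z≤n) 3≤n))
    ... | yes a<m  | yes b<M =
      ∈-concatMap⁺ column (lose (∈-upTo⁺ a<m)
        (∈-map⁺ (a ,_) (∈-filter⁺ (λ b → f (suc a) (suc b) ≟ n) (∈-upTo⁺ b<M) e)))

    quadrant-unique : Unique quadrant
    quadrant-unique = concatMap-unique column (Unique.upTo⁺ m)
      (λ {a} _ → Unique.map⁺ (cong proj₂) (Unique.filter⁺ (λ b → f (suc a) (suc b) ≟ n) (Unique.upTo⁺ M)))
      (λ _ _ z∈x z∈y → trans (sym (proj₁ (∈-column⁻ z∈x))) (proj₁ (∈-column⁻ z∈y)))

    corners : ℕ × ℕ → List Toothpick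
    corners (a , b) = site (+ suc a , + suc b) ∷ site (+ suc a , -[1+ b ]) ∷
                      site (-[1+ a ] , + suc b) ∷ site (-[1+ a ] , -[1+ b ]) ∷ []

    ∈-corners⁻ : ∀ {T} q → T ∈ corners q →
                 IsSite T × ∣ proj₁ (mid T) ∣ ≡ suc (proj₁ q) × ∣ proj₂ (mid T) ∣ ≡ suc (proj₂ q)
    ∈-corners⁻ _ (here refl)                         = refl , refl , refl
    ∈-corners⁻ _ (there (here refl))                 = refl , refl , refl
    ∈-corners⁻ _ (there (there (here refl)))         = refl , refl , refl
    ∈-corners⁻ _ (there (there (there (here refl)))) = refl , refl , refl

    all : List Toothpick
    all = concatMap corners quadrant

    all-unique : Unique all
    all-unique = concatMap-unique corners quadrant-unique
      (λ _ → ((λ ()) ∷ (λ ()) ∷ (λ ()) ∷ []) ∷ ((λ ()) ∷ (λ ()) ∷ []) ∷ ((λ ()) ∷ []) ∷ [] ∷ [])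
      λ {x} {y} _ _ z∈x z∈y → let _ , e₁ , e₂ = ∈-corners⁻ x z∈x ; _ , e₃ , e₄ = ∈-corners⁻ y z∈y in
        cong₂ _,_ (suc-injective (trans (sym e₁) e₃)) (suc-injective (trans (sym e₂) e₄))

    ∈-all⁻ : ∀ {T} → T ∈ all → IsSite T × F (mid T) ≡ n
    ∈-all⁻ T∈ with find (∈-concatMap⁻ corners {xs = quadrant} T∈)
    ... | q , q∈ , T∈q with ∈-corners⁻ q T∈q
    ...   | isT , e₁ , e₂ = isT , trans (cong₂ f e₁ e₂) (∈-quadrant⁻ q∈)

    private
      axis-early : ∀ y → f 0 y ≢ n
      axis-early 0 e = contradiction (subst (3 ≤_) (trans (sym e) f00) 3≤n) λ { (s≤s ()) }
      axis-early 1 e = contradiction (subst (3 ≤_) (trans (sym e) f01) 3≤n) λ { (s≤s (s≤s ())) }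
      axis-early (suc (suc y)) e = contradiction (subst (3 ≤_) (trans (sym e) (f0y y)) 3≤n) λ ()

      axis-early′ : ∀ x → f x 0 ≢ n
      axis-early′ zero = axis-early 0
      axis-early′ (suc x) e = contradiction (subst (3 ≤_) (trans (sym e) (fx0 x)) 3≤n) λ ()

    site∈all : ∀ p → F p ≡ n → site p ∈ all
    site∈all (+ 0       , y)        e = contradiction e (axis-early ∣ y ∣)
    site∈all (+ suc a   , + 0)      e = contradiction e (axis-early′ (suc a))
    site∈all (-[1+ a ]  , + 0)      e = contradiction e (axis-early′ (suc a))
    site∈all (+ suc a   , + suc b)  e = ∈-concatMap⁺ corners (lose (∈-quadrant⁺ e) (here refl))
    site∈all (+ suc a   , -[1+ b ]) e = ∈-concatMap⁺ corners (lose (∈-quadrant⁺ e) (there (here refl)))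
    site∈all (-[1+ a ]  , + suc b)  e = ∈-concatMap⁺ corners (lose (∈-quadrant⁺ e) (there (there (here refl))))
    site∈all (-[1+ a ]  , -[1+ b ]) e = ∈-concatMap⁺ corners (lose (∈-quadrant⁺ e) (there (there (there (here refl)))))

    length-all : length all ≡ 4 * count m f n
    length-all = trans (length-concatMap-const corners (λ _ → refl) quadrant)
                       (trans (*-comm (length quadrant) 4) (cong (4 *_) length-quadrant))

  -- From age 3 on no toothpick is centred on an axis, so the four reflections of a point are
  -- distinct.
  t-count : ∀ n → 3 ≤ n → n ≤ M + M → t n ≡ 4 * count m f n
  t-count (suc zero) (s≤s ()) _
  t-count (suc (suc j)) 3≤n n≤2M =
    trans (unique-length added-unique (all-unique n 3≤n) to from) (length-all n 3≤n)
    where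
    n = suc (suc j)
    open Stages (stages j (<⇒≤ n≤2M))
    open Stage (suc j) (s≤s z≤n) n≤2M (structure (suc j)) unique on⇒∈ ∈⇒on
    to : ∀ {T} → T ∈ added (structure (suc j)) → T ∈ all n 3≤n
    to {T} T∈ = let isT , e = added⇒new T∈ in subst (_∈ all n 3≤n) (sym isT) (site∈all n 3≤n (mid T) e)
    from : ∀ {T} → T ∈ all n 3≤n → T ∈ added (structure (suc j))
    from T∈ = new⇒added (∈-all⁻ n 3≤n T∈)

  count-late : ∀ {n} → M + M < n → count m f n ≡ 0
  count-late lt = ∑-zero m λ {a} _ → ∑-zero M λ {b} _ → hit-≢ (<⇒≢ (≤-<-trans (bound (suc a) (suc b)) lt))

  count-early : ∀ {n} → 1 ≤ n → n < 3 → count m f n ≡ 0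
  count-early {n} 1≤n n<3 = ∑-zero m λ {a} _ → ∑-zero M λ {b} _ → hit-≢ (early a b)
    where
    early : ∀ a b → f (suc a) (suc b) ≢ n
    early a b e with inner a b
    ... | inj₁ z = <⇒≢ 1≤n (trans (sym z) e)
    ... | inj₂ l = <⇒≱ n<3 (subst (3 ≤_) e l)

  open Grow m f using (grow-SW; grow-NW; grow-NE; grow-SE)

  private
    g = grow m f
    M′ = M + M

  -- The summands are the corner (M , M), the toothpick (M , M + 1), the blocks NW, NE and SE
  count-grow : ∀ i → 1 ≤ i → count (m + M) g (M′ + i) ≡
               hit i 1 + hit i 2 + (count m f i + count m f i) + count m f (suc i)
  count-grow i 1≤i = begin
    ∑ (m + M) (λ a → ∑ M′ (λ b → h a b))
      ≡⟨ ∑-split m M _ ⟩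
    ∑ m (λ a → ∑ M′ (λ b → h a b)) + ∑ M (λ c → ∑ M′ (λ b → h (m + c) b))
      ≡⟨ cong₂ _+_ west east ⟩
    count m f i + (count m f (suc i) + (hit i 1 + (hit i 2 + 0) + count m f i))
      ≡⟨ arith (count m f i) (count m f (suc i)) (hit i 1) (hit i 2) ⟩
    hit i 1 + hit i 2 + (count m f i + count m f i) + count m f (suc i) ∎
    where
    open ≡-Reasoning
    h : ℕ → ℕ → ℕ
    h a b = hit (M′ + i) (g (suc a) (suc b))

    arith : ∀ c d x y → c + (d + (x + (y + 0) + c)) ≡ x + y + (c + c) + d
    arith = solve-∀

    -- Ages in the old block are at most `M + M`, so only NW contributes, with its columns in
    -- reversed order.
    west : ∑ m (λ a → ∑ M′ (λ b → h a b)) ≡ count m f i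
    west = begin
      ∑ m (λ a → ∑ M′ (λ b → h a b))
        ≡⟨ ∑-cong m (λ {a} a<m → trans (∑-split M M (h a)) (cong (_+ ∑ M (λ b → h a (M + b))) (∑-zero M (λ {b} b<M →
             trans (cong (hit (M′ + i)) (grow-SW (s≤s a<m) b<M)) (hit-≢ (<⇒≢ (≤-<-trans (bound (suc a) (suc b)) (m<m+n M′ 1≤i)))))))) ⟩
      ∑ m (λ a → ∑ M (λ b → h a (M + b)))
        ≡⟨ ∑-reverse m (λ a j e → ∑-cong M (λ {b} _ →
             trans (cong (hit (M′ + i)) (trans (cong (g (suc a)) (sym (+-suc M b))) (grow-NW (suc a) (suc j) b (cong suc e))))
                   (hit-sh M′ (f (suc j) (suc b)) 1≤i))) ⟩
      count m f i ∎

    -- The turned copy asks for exchanged sums, one of them reversed. Its delay `m + M` is one short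
    -- of `M′`, which leaves `suc i`.
    south : ∑ M (λ c → ∑ m (λ b → h (m + c) b)) ≡ count m f (suc i)
    south = begin
      ∑ M (λ c → ∑ m (λ b → h (m + c) b)) ≡⟨ ∑-swap M m (λ c b → h (m + c) b) ⟩
      ∑ m (λ b → ∑ M (λ c → h (m + c) b))
        ≡⟨ ∑-reverse m (λ b j e → ∑-cong M (λ {c} _ →
             trans (cong₂ hit (sym (+-suc (m + M) i)) (grow-SE A c (suc b) (suc j) (cong suc e)))
                   (hit-sh (m + M) (f (suc j) (suc c)) (s≤s z≤n)))) ⟩
      count m f (suc i) ∎

    h-NE : ∀ c d → h (m + c) (m + d) ≡ hit i (f c d)
    h-NE c d = trans (cong (hit (M′ + i)) (grow-NE c d)) (hit-sh M′ (f c d) 1≤i)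

    hit-0 : ∀ {v} → v ≡ 0 → hit i v ≡ 0
    hit-0 refl = hit-≢ (<⇒≢ 1≤i)

    -- This part includes the axes of NE: column `c = 0` carries ages 1 and 2 of the copy, row
    -- `d = 0` nothing more.
    north : ∑ M (λ c → ∑ (suc M) (λ d → h (m + c) (m + d))) ≡ hit i 1 + (hit i 2 + 0) + count m f i
    north = begin
      ∑ M (λ c → ∑ (suc M) (λ d → h (m + c) (m + d)))
        ≡⟨ ∑-cong M (λ {c} _ → ∑-cong (suc M) (λ {d} _ → h-NE c d)) ⟩
      hit i (f 0 0) + (hit i (f 0 1) + ∑ m (λ d → hit i (f 0 (2 + d)))) + ∑ m (λ c → hit i (f (suc c) 0) + ∑ M (λ d → hit i (f (suc c) (suc d))))
        ≡⟨ cong₂ _+_ (cong₂ _+_ (cong (hit i) f00) (cong₂ _+_ (cong (hit i) f01) (∑-zero m (λ {d} _ → hit-0 (f0y d)))))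
             (∑-cong m (λ {c} _ → cong (_+ ∑ M (λ d → hit i (f (suc c) (suc d)))) (hit-0 (fx0 c)))) ⟩
      hit i 1 + (hit i 2 + 0) + count m f i ∎

    east : ∑ M (λ c → ∑ M′ (λ b → h (m + c) b)) ≡ count m f (suc i) + (hit i 1 + (hit i 2 + 0) + count m f i)
    east = begin
      ∑ M (λ c → ∑ M′ (λ b → h (m + c) b))
        ≡⟨ ∑-cong M (λ {c} _ → trans (cong (λ k → ∑ k (h (m + c))) (sym (+-suc m M))) (∑-split m (suc M) (h (m + c)))) ⟩
      ∑ M (λ c → ∑ m (λ b → h (m + c) b) + ∑ (suc M) (λ d → h (m + c) (m + d)))
        ≡⟨ ∑-+ M (λ c → ∑ m (λ b → h (m + c) b)) (λ c → ∑ (suc M) (λ d → h (m + c) (m + d))) ⟩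
      ∑ M (λ c → ∑ m (λ b → h (m + c) b)) + ∑ M (λ c → ∑ (suc M) (λ d → h (m + c) (m + d)))
        ≡⟨ cong₂ _+_ south north ⟩
      count m f (suc i) + (hit i 1 + (hit i 2 + 0) + count m f i) ∎

-- The binomial series

wtAux-0 : ∀ f → wtAux f 0 ≡ 0
wtAux-0 zero    = refl
wtAux-0 (suc f) = wtAux-0 f

wtAux-fuel : ∀ f f′ n → n ≤ f → n ≤ f′ → wtAux f n ≡ wtAux f′ n
wtAux-fuel f f′ zero _ _ = trans (wtAux-0 f) (sym (wtAux-0 f′))
wtAux-fuel (suc f) (suc f′) n@(suc _) n≤f n≤f′ =
  cong (λ u → n % 2 + u) (wtAux-fuel f f′ (n / 2) (shrink n≤f) (shrink n≤f′))
  where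
  shrink : ∀ {g} → n ≤ suc g → n / 2 ≤ g
  shrink le = s≤s⁻¹ (≤-trans (m/n<m n 2 (s≤s (s≤s z≤n))) le)

wt-step : ∀ n → wt n ≡ n % 2 + wt (n / 2)
wt-step zero      = refl
wt-step n@(suc l) = cong (λ u → n % 2 + u) (wtAux-fuel l (n / 2) (n / 2) (s≤s⁻¹ (m/n<m n 2 (s≤s (s≤s z≤n)))) ≤-refl)

wt-even : ∀ q → wt (q * 2) ≡ wt q
wt-even q = trans (wt-step (q * 2)) (cong₂ _+_ (m*n%n≡0 q 2) (cong wt (m*n/n≡m q 2)))

wt-odd : ∀ q → wt (suc (q * 2)) ≡ suc (wt q)
wt-odd q = trans (wt-step (suc (q * 2))) (cong₂ _+_ ([m+kn]%n≡m%n 1 q 2)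
  (cong wt (trans (+-distrib-/-∣ʳ 1 {q * 2} (divides-refl q)) (m*n/n≡m q 2))))

half : ∀ n → ∃[ q ] (n ≡ q * 2 ⊎ n ≡ suc (q * 2))
half zero = 0 , inj₁ refl
half (suc n) with half n
... | q , inj₁ refl = q , inj₂ refl
... | q , inj₂ refl = suc q , inj₁ refl

private
  q≤q*2 : ∀ q → q ≤ q * 2
  q≤q*2 q = m≤m*n q 2

wt-suc : ∀ n → wt (suc n) ≤ suc (wt n)
wt-suc n = go n n ≤-refl
  where
  go : ∀ b n → n ≤ b → wt (suc n) ≤ suc (wt n)
  go b n n≤b with half n
  go b       _ _   | q , inj₁ refl = ≤-reflexive (trans (wt-odd q) (cong suc (sym (wt-even q))))
  go (suc b) _ n≤b | q , inj₂ refl = begin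
    wt (suc q * 2)         ≡⟨ wt-even (suc q) ⟩
    wt (suc q)             ≤⟨ go b q (≤-trans (q≤q*2 q) (s≤s⁻¹ n≤b)) ⟩
    suc (wt q)             ≡⟨ sym (wt-odd q) ⟩
    wt (suc (q * 2))       ≤⟨ n≤1+n _ ⟩
    suc (wt (suc (q * 2))) ∎
    where open ≤-Reasoning

-- Makes the series finite: it yields `wt (i + m) < m` once `2 + i ≤ m`.
wt-small : ∀ n → wt n * 2 ≤ suc n
wt-small n = go n n ≤-refl
  where
  open ≤-Reasoning
  go : ∀ b n → n ≤ b → wt n * 2 ≤ suc n
  go b n n≤b with half n
  go b       _ _   | zero , inj₁ refl = z≤n
  go b       _ _   | zero , inj₂ refl = ≤-refl
  go (suc b) _ n≤b | suc q , inj₁ refl = begin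
    wt (suc q * 2) * 2   ≡⟨ cong (_* 2) (wt-even (suc q)) ⟩
    wt (suc q) * 2       ≤⟨ go b (suc q) (≤-trans (s≤s (q≤q*2 q)) (s≤s⁻¹ n≤b)) ⟩
    suc (suc q)          ≤⟨ s≤s (q≤q*2 (suc q)) ⟩
    suc (suc q * 2)      ∎
  go (suc b) _ n≤b | suc q , inj₂ refl = begin
    wt (suc (suc q * 2)) * 2 ≡⟨ cong (_* 2) (wt-odd (suc q)) ⟩
    2 + wt (suc q) * 2       ≤⟨ +-monoʳ-≤ 2 (go b (suc q) (≤-trans (q≤q*2 (suc q)) (s≤s⁻¹ n≤b))) ⟩
    4 + q                    ≤⟨ +-monoʳ-≤ 4 (q≤q*2 q) ⟩
    2 + suc q * 2            ∎

2^suc : ∀ j → 2 ^ suc j ≡ 2 ^ j + 2 ^ j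
2^suc j = cong (λ u → 2 ^ j + u) (+-identityʳ (2 ^ j))

wt-2^+ : ∀ j r → r < 2 ^ j → wt (2 ^ j + r) ≡ suc (wt r)
wt-2^+ zero    zero _ = refl
wt-2^+ zero    (suc r) (s≤s ())
wt-2^+ (suc j) r lt with half r
... | q , inj₁ refl = begin
  wt (2 * 2 ^ j + q * 2)       ≡⟨ cong wt (ring (2 ^ j) q) ⟩
  wt ((2 ^ j + q) * 2)         ≡⟨ wt-even (2 ^ j + q) ⟩
  wt (2 ^ j + q)
    ≡⟨ wt-2^+ j q (*-cancelʳ-< 2 q (2 ^ j) (subst (q * 2 <_) (*-comm 2 (2 ^ j)) lt)) ⟩
  suc (wt q)                   ≡⟨ cong suc (sym (wt-even q)) ⟩
  suc (wt (q * 2))             ∎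
  where
  open ≡-Reasoning
  ring : ∀ p q → 2 * p + q * 2 ≡ (p + q) * 2
  ring = solve-∀
... | q , inj₂ refl = begin
  wt (2 * 2 ^ j + suc (q * 2)) ≡⟨ cong wt (ring (2 ^ j) q) ⟩
  wt (suc ((2 ^ j + q) * 2))   ≡⟨ wt-odd (2 ^ j + q) ⟩
  suc (wt (2 ^ j + q))
    ≡⟨ cong suc (wt-2^+ j q (*-cancelʳ-< 2 q (2 ^ j) (<-trans (n<1+n _) (subst (suc (q * 2) <_) (*-comm 2 (2 ^ j)) lt)))) ⟩
  suc (suc (wt q))             ≡⟨ cong suc (sym (wt-odd q)) ⟩
  suc (wt (suc (q * 2)))       ∎
  where
  open ≡-Reasoning
  ring : ∀ p q → 2 * p + suc (q * 2) ≡ suc ((p + q) * 2)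
  ring = solve-∀

2^>0 : ∀ j → 1 ≤ 2 ^ j
2^>0 j = m^n>0 2 j

wt-2^ : ∀ j → wt (2 ^ j) ≡ 1
wt-2^ j = trans (cong wt (sym (+-identityʳ (2 ^ j)))) (wt-2^+ j 0 (2^>0 j))

wt-+-≤ : ∀ n {w} → wt n ≤ w → ∀ e → wt (n + e) ≤ w + e
wt-+-≤ n {w} le zero = subst₂ _≤_ (cong wt (sym (+-identityʳ n))) (sym (+-identityʳ w)) le
wt-+-≤ n {w} le (suc e) = subst₂ _≤_ (cong wt (sym (+-suc n e))) (sym (+-suc w e))
  (≤-trans (wt-suc (n + e)) (s≤s (wt-+-≤ n le e)))

wt-2^∸1 : ∀ j {r} → suc r ≡ 2 ^ j → wt r ≡ j
wt-2^∸1 zero    refl = refl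
wt-2^∸1 (suc j) {r} e = begin
  wt r
    ≡⟨ cong wt (suc-injective (trans e (trans (2^suc j) (trans (cong (λ u → 2 ^ j + u) (sym e′)) (+-suc (2 ^ j) s))))) ⟩
  wt (2 ^ j + s)  ≡⟨ wt-2^+ j s (≤-reflexive e′) ⟩
  suc (wt s)      ≡⟨ cong suc (wt-2^∸1 j e′) ⟩
  suc j           ∎
  where
  open ≡-Reasoning
  s = pred (2 ^ j)
  e′ : suc s ≡ 2 ^ j
  e′ = suc-pred (2 ^ j) {{>-nonZero (2^>0 j)}}

-- coeff w m is the coefficient of x^m in (2 + x)^w
coeff : ℕ → ℕ → ℕ
coeff w m = 2 ^ (w ∸ m) * (w C m)

coeff-vanish : ∀ {w m} → w < m → coeff w m ≡ 0
coeff-vanish {w} {m} lt = trans (cong (2 ^ (w ∸ m) *_) (k>n⇒nCk≡0 lt)) (*-zeroʳ (2 ^ (w ∸ m)))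

coeff-0 : ∀ w → coeff w 0 ≡ 2 ^ w
coeff-0 w = *-identityʳ (2 ^ w)

coeff-pascal : ∀ w m → coeff (suc w) (suc m) ≡ 2 * coeff w (suc m) + coeff w m
coeff-pascal w m = begin
  2 ^ (w ∸ m) * (suc w C suc m)
    ≡⟨ cong (2 ^ (w ∸ m) *_) (sym (nCk+nC[k+1]≡[n+1]C[k+1] w m)) ⟩
  2 ^ (w ∸ m) * (w C m + w C suc m)                   ≡⟨ *-distribˡ-+ (2 ^ (w ∸ m)) (w C m) (w C suc m) ⟩
  coeff w m + 2 ^ (w ∸ m) * (w C suc m)               ≡⟨ cong (λ u → coeff w m + u) scale ⟩
  coeff w m + 2 * coeff w (suc m)                     ≡⟨ +-comm (coeff w m) _ ⟩
  2 * coeff w (suc m) + coeff w m                     ∎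
  where
  open ≡-Reasoning
  scale : 2 ^ (w ∸ m) * (w C suc m) ≡ 2 * coeff w (suc m)
  scale with suc m ≤? w
  ... | yes m<w = trans (cong (λ u → 2 ^ u * (w C suc m)) (sym (trans (sym (+-∸-assoc 1 m<w)) refl))) (*-assoc 2 (2 ^ (w ∸ suc m)) (w C suc m))
  -- Truncation spoils the exponents here, but the binomial coefficient is `0` on both sides.
  ... | no  m≮w = trans (trans (cong (2 ^ (w ∸ m) *_) (k>n⇒nCk≡0 (≰⇒> m≮w))) (*-zeroʳ (2 ^ (w ∸ m))))
                        (cong (2 *_) (sym (coeff-vanish (≰⇒> m≮w))))

term-vanish : ∀ {i m} → 2 + i ≤ m → term i m ≡ 0
term-vanish {i} {m} le = coeff-vanish (*-cancelʳ-< 2 (wt (i + m)) m (begin-strict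
  wt (i + m) * 2 ≤⟨ wt-small (i + m) ⟩
  suc i + m      <⟨ +-monoˡ-< m le ⟩
  m + m          ≡⟨ double m ⟩
  m * 2          ∎))
  where
  open ≤-Reasoning
  double : ∀ m → m + m ≡ m * 2
  double = solve-∀

∑-extend : ∀ k l h → (∀ {m} → k ≤ m → h m ≡ 0) → ∑ (k + l) h ≡ ∑ k h
∑-extend k l h vanish = trans (∑-split k l h)
  (trans (cong (λ u → ∑ k h + u) (∑-zero l λ {i} _ → vanish (m≤m+n k i))) (+-identityʳ (∑ k h)))

-- The freedom in the range lets the recurrence sum series with different indices over matching
-- ranges.
series-∑ : ∀ i {k} → 2 + i ≤ k → series i ≡ ∑ k (term i)
series-∑ i {k} le = trans (cong sum (map-upTo (term i) (i + 8))) (trans (to-min (m≤m+n (2 + i) 6) refl′) (sym (to-min le refl)))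
  where
  refl′ : i + 8 ≡ 2 + i + 6
  refl′ = solve i
    where
    solve : ∀ i → i + 8 ≡ 2 + i + 6
    solve = solve-∀
  to-min : ∀ {k′} → 2 + i ≤ k′ → ∀ {k} → k ≡ k′ → ∑ k (term i) ≡ ∑ (2 + i) (term i)
  to-min {k′} le {k} refl = trans (cong (λ u → ∑ u (term i)) (sym (m+[n∸m]≡n le)))
                              (∑-extend (2 + i) (k ∸ (2 + i)) (term i) term-vanish)

-- Splitting off the leading bit

module Split (j r : ℕ) where

  i : ℕ
  i = 2 ^ j + r

  term-0 : r < 2 ^ j → term i 0 ≡ 2 * term r 0
  term-0 lt = begin
    coeff (wt (i + 0)) 0          ≡⟨ cong (λ u → coeff (wt u) 0) (+-identityʳ i) ⟩
    coeff (wt i) 0                ≡⟨ cong (λ u → coeff u 0) (wt-2^+ j r lt) ⟩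
    coeff (suc (wt r)) 0          ≡⟨ *-assoc 2 (2 ^ wt r) 1 ⟩
    2 * coeff (wt r) 0            ≡⟨ cong (λ u → 2 * coeff (wt u) 0) (sym (+-identityʳ r)) ⟩
    2 * coeff (wt (r + 0)) 0      ∎
    where open ≡-Reasoning

  -- As long as `r + suc m` does not carry into the leading bit, that bit just adds 1 to the weight,
  -- and Pascal's rule applies.
  term-suc : ∀ m → r + suc m < 2 ^ j → term i (suc m) ≡ 2 * term r (suc m) + term (suc r) m
  term-suc m lt = begin
    coeff (wt (2 ^ j + r + suc m)) (suc m)
      ≡⟨ cong (λ u → coeff (wt u) (suc m)) (+-assoc (2 ^ j) r (suc m)) ⟩
    coeff (wt (2 ^ j + (r + suc m))) (suc m) ≡⟨ cong (λ u → coeff u (suc m)) (wt-2^+ j (r + suc m) lt) ⟩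
    coeff (suc (wt (r + suc m))) (suc m)     ≡⟨ coeff-pascal (wt (r + suc m)) m ⟩
    2 * term r (suc m) + coeff (wt (r + suc m)) m
      ≡⟨ cong (λ u → 2 * term r (suc m) + coeff (wt u) m) (+-suc r m) ⟩
    2 * term r (suc m) + term (suc r) m      ∎
    where open ≡-Reasoning

  module _ {d} (gap : r + d ≡ 2 ^ j) where

    -- Once the sum carries it is `2 ^ j + e` with `m` = `d + e`. Each increment adds at most 1 to
    -- the weight, so the weight is at most `1 + e` and below `m`.
    term-r-vanish : ∀ {m} → 2 ≤ d → d ≤ m → term r m ≡ 0
    term-r-vanish {m} 2≤d d≤m with m ∸ d | m+[n∸m]≡n d≤m
    ... | e | refl = coeff-vanish (begin-strict
      wt (r + (d + e))   ≡⟨ cong wt (trans (sym (+-assoc r d e)) (cong (_+ e) gap)) ⟩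
      wt (2 ^ j + e)     ≤⟨ wt-+-≤ (2 ^ j) (≤-reflexive (wt-2^ j)) e ⟩
      1 + e              <⟨ +-monoˡ-≤ e 2≤d ⟩
      d + e              ∎)
      where open ≤-Reasoning

    -- The same carry happens one index earlier, which costs one more unit of `d`.
    term-r+1-vanish : ∀ {m} → 3 ≤ d → d ≤ suc m → term (suc r) m ≡ 0
    term-r+1-vanish {m} 3≤d d≤m with suc m ∸ d | m+[n∸m]≡n d≤m
    ... | e | eq = coeff-vanish (s≤s⁻¹ (begin-strict
      suc (wt (suc r + m))
        ≡⟨ cong (suc ∘ wt) (trans (sym (+-suc r m)) (trans (cong (λ u → r + u) (sym eq)) (trans (sym (+-assoc r d e)) (cong (_+ e) gap)))) ⟩
      suc (wt (2 ^ j + e))   ≤⟨ s≤s (wt-+-≤ (2 ^ j) (≤-reflexive (wt-2^ j)) e) ⟩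
      2 + e              <⟨ +-monoˡ-≤ e 3≤d ⟩
      d + e              ≡⟨ eq ⟩
      suc m              ∎))
      where open ≤-Reasoning

    term-i-vanish : ∀ {m} → 2 ≤ d → d ≤ m → term i m ≡ 0
    term-i-vanish {m} 2≤d d≤m with m ∸ d | m+[n∸m]≡n d≤m
    ... | e | refl = coeff-vanish (begin-strict
      wt (2 ^ j + r + (d + e))
        ≡⟨ cong wt (trans (sym (+-assoc (2 ^ j + r) d e)) (cong (_+ e) (trans (+-assoc (2 ^ j) r d) (trans (cong (λ u → 2 ^ j + u) gap) (sym (2^suc j)))))) ⟩
      wt (2 ^ suc j + e)     ≤⟨ wt-+-≤ (2 ^ suc j) (≤-reflexive (wt-2^ (suc j))) e ⟩
      1 + e              <⟨ +-monoˡ-≤ e 2≤d ⟩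
      d + e              ∎)
      where open ≤-Reasoning

    private
      inside : ∀ {m} → m < d → r + m < 2 ^ j
      inside lt = subst (_ <_) gap (+-monoʳ-< r lt)

      r<2^j : 2 ≤ d → r < 2 ^ j
      r<2^j 2≤d = subst (_< 2 ^ j) (+-identityʳ r) (inside (≤-trans (s≤s z≤n) 2≤d))

    series-far : 3 ≤ d → series i ≡ 2 * series r + series (suc r)
    series-far 3≤d = begin
      series i
        ≡⟨ series-∑ i (n≤1+n (2 + i)) ⟩
      term i 0 + ∑ k (λ m → term i (suc m))
        ≡⟨ cong₂ _+_ (term-0 (r<2^j 2≤d)) (∑-cong k (λ {m} _ → step m)) ⟩
      2 * term r 0 + ∑ k (λ m → 2 * term r (suc m) + term (suc r) m)
        ≡⟨ cong (λ u → 2 * term r 0 + u) (∑-+ k (λ m → 2 * term r (suc m)) (term (suc r))) ⟩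
      2 * term r 0 + (∑ k (λ m → 2 * term r (suc m)) + ∑ k (term (suc r)))
        ≡⟨ sym (+-assoc (2 * term r 0) _ _) ⟩
      ∑ (suc k) (λ m → 2 * term r m) + ∑ k (term (suc r))
        ≡⟨ cong (_+ ∑ k (term (suc r))) (∑-double (suc k) (term r)) ⟩
      2 * ∑ (suc k) (term r) + ∑ k (term (suc r))
        ≡⟨ cong₂ (λ u v → 2 * u + v) (sym (series-∑ r {suc k} (s≤s (s≤s (m≤n⇒m≤1+n (m≤n+m r (2 ^ j))))))) (sym (series-∑ (suc r) {k} (s≤s (s≤s (+-monoˡ-≤ r (2^>0 j)))))) ⟩
      2 * series r + series (suc r) ∎
      where
      open ≡-Reasoning
      k = 2 + i
      2≤d : 2 ≤ d
      2≤d = <⇒≤ 3≤d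
      ∑-double : ∀ k h → ∑ k (λ m → 2 * h m) ≡ 2 * ∑ k h
      ∑-double zero    h = refl
      ∑-double (suc k) h = trans (cong (λ u → 2 * h 0 + u) (∑-double k (h ∘ suc))) (sym (*-distribˡ-+ 2 (h 0) _))
      step : ∀ m → term i (suc m) ≡ 2 * term r (suc m) + term (suc r) m
      step m with suc m <? d
      ... | yes lt = term-suc m (inside lt)
      ... | no  ge = trans (term-i-vanish 2≤d (≮⇒≥ ge))
                       (sym (cong₂ (λ u v → 2 * u + v) (term-r-vanish 2≤d (≮⇒≥ ge)) (term-r+1-vanish 3≤d (≮⇒≥ ge))))

  -- Here `term (suc r)` equals 1 at the indices 1 and 2, after the carry, where `term i` and
  -- `term r` are already silent one index later. So only its leading term `2 ^ j` enters, not the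
  -- full `series (suc r)`.
  series-penultimate : r + 2 ≡ 2 ^ j → series i ≡ 2 * series r + 2 ^ j
  series-penultimate gap = begin
    series i                             ≡⟨ series-∑ i ≤-refl ⟩
    ∑ (2 + i) (term i)                   ≡⟨ ∑-extend 2 i (term i) (term-i-vanish gap ≤-refl) ⟩
    term i 0 + (term i 1 + 0)            ≡⟨ cong₂ _+_ (term-0 r<) (cong (_+ 0) (term-suc 0 r+1<)) ⟩
    2 * term r 0 + (2 * term r 1 + term (suc r) 0 + 0) ≡⟨ ring (term r 0) (term r 1) (term (suc r) 0) ⟩
    2 * (term r 0 + (term r 1 + 0)) + term (suc r) 0
      ≡⟨ cong₂ (λ u v → 2 * u + v) (sym (∑-extend 2 r (term r) (term-r-vanish gap ≤-refl))) last ⟩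
    2 * ∑ (2 + r) (term r) + 2 ^ j       ≡⟨ cong (λ u → 2 * u + 2 ^ j) (sym (series-∑ r ≤-refl)) ⟩
    2 * series r + 2 ^ j                 ∎
    where
    open ≡-Reasoning
    r+1< : r + 1 < 2 ^ j
    r+1< = subst (r + 1 <_) gap (+-monoʳ-< r (s≤s (s≤s z≤n)))
    r< : r < 2 ^ j
    r< = subst (r <_) gap (m<m+n r (s≤s z≤n))
    ring : ∀ x y z → 2 * x + (2 * y + z + 0) ≡ 2 * (x + (y + 0)) + z
    ring = solve-∀
    last : term (suc r) 0 ≡ 2 ^ j
    last = trans (coeff-0 (wt (suc r + 0))) (cong (2 ^_) (wt-2^∸1 j (trans (cong (suc ∘ suc) (+-identityʳ r)) (trans (+-comm 2 r) gap))))

wt-2^+2 : ∀ j → wt (2 ^ suc j + 2) ≤ 2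
wt-2^+2 zero    = s≤s z≤n
wt-2^+2 (suc j) = ≤-reflexive (wt-2^+ (2 + j) 2 (begin-strict
    2                 <⟨ s≤s (s≤s (s≤s z≤n)) ⟩
    4                 ≤⟨ ^-monoʳ-≤ 2 (s≤s (s≤s (z≤n {j}))) ⟩
    2 ^ (2 + j)       ∎))
  where open ≤-Reasoning

-- The numbers `i`, `i + 1`, `i + 2` have weights `suc j`, 1 and 2, and give the only nonzero terms.
-- Afterwards the weight lags behind `m`.
series-2^∸1 : ∀ j {i} → suc i ≡ 2 ^ suc j → series i ≡ 2 ^ suc j + 2
series-2^∸1 j {i} e = begin
  series i                                  ≡⟨ series-∑ i {3 + i} (n≤1+n _) ⟩
  ∑ (3 + i) (term i)                        ≡⟨ ∑-extend 3 i (term i) vanish ⟩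
  term i 0 + (term i 1 + (term i 2 + 0))    ≡⟨ cong₂ _+_ first (cong₂ (λ u v → u + (v + 0)) second third) ⟩
  2 ^ suc j + 2                             ∎
  where
  open ≡-Reasoning
  2^J = 2 ^ suc j
  shift : ∀ m → i + suc m ≡ 2^J + m
  shift m = trans (+-suc i m) (cong (_+ m) e)
  first : term i 0 ≡ 2^J
  first = trans (coeff-0 (wt (i + 0))) (cong (2 ^_) (wt-2^∸1 (suc j) (trans (cong suc (+-identityʳ i)) e)))
  second : term i 1 ≡ 1
  second = cong (λ u → coeff u 1) (trans (cong wt (trans (shift 0) (+-identityʳ 2^J))) (wt-2^ (suc j)))
  third : term i 2 ≡ 1
  third = cong (λ u → coeff u 2) (trans (cong wt (shift 1)) (wt-2^+ (suc j) 1 (^-monoʳ-≤ 2 (s≤s (z≤n {j})))))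
  vanish : ∀ {m} → 3 ≤ m → term i m ≡ 0
  vanish {1} (s≤s ())
  vanish {2} (s≤s (s≤s ()))
  vanish {suc (suc (suc m))} _ = coeff-vanish (s≤s (subst (λ u → wt u ≤ 2 + m)
    (sym (trans (shift (2 + m)) (sym (+-assoc 2^J 2 m)))) (wt-+-≤ (2^J + 2) (wt-2^+2 j) m)))

-- The recurrence

suc-pred2^ : ∀ k → suc (pred2^ k) ≡ 2 ^ suc k
suc-pred2^ zero    = refl
suc-pred2^ (suc k) = trans (cong₂ _+_ (suc-pred2^ k) (suc-pred2^ k)) (sym (2^suc (suc k)))

module _ {m f} (A : Ages m f) where
  private
    M = suc m
    A′ = Grow.grow-ages m f A

    t-next : ∀ i → 1 ≤ i → i ≤ M + M →
             t (M + M + i) ≡ 4 * (hit i 1 + hit i 2 + (count m f i + count m f i) + count m f (suc i))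
    t-next i 1≤i i≤ = trans
      (t-count A′ (M + M + i) (s≤s (≤-trans (+-mono-≤ {1} {m + M} {1} (m≤n⇒m≤o+n m (s≤s z≤n)) 1≤i) ≤-refl)) (+-monoʳ-≤ (M + M) i≤))
      (cong (4 *_) (count-grow A i 1≤i))

    4≤2M : 4 ≤ M + M
    4≤2M = +-mono-≤ 2≤M 2≤M
      where 2≤M = s≤s (even-suc⇒1≤ m (Ages.even-M A))

  -- In the last stage only NE and NW grow; SE would need an age above `M + M`.
  t-double : t (M + M + (M + M)) ≡ 2 * t (M + M)
  t-double = begin
    t (M + M + (M + M))              ≡⟨ t-next (M + M) (s≤s z≤n) ≤-refl ⟩
    4 * (hit (M + M) 1 + hit (M + M) 2 + (c + c) + count m f (suc (M + M)))
      ≡⟨ cong (λ u → 4 * u) (cong₂ _+_ (cong₂ _+_ (cong₂ _+_ (hit-≢ (<⇒≢ (≤-trans (s≤s (s≤s z≤n)) 4≤2M))) (hit-≢ (<⇒≢ (≤-trans (n≤1+n 3) 4≤2M)))) (refl {x = c + c})) (count-late A ≤-refl)) ⟩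
    4 * (c + c + 0)                  ≡⟨ ring c ⟩
    2 * (4 * c)
      ≡⟨ cong (2 *_) (sym (t-count A (M + M) (≤-trans (n≤1+n 3) 4≤2M) ≤-refl)) ⟩
    2 * t (M + M)                    ∎
    where
    open ≡-Reasoning
    c = count m f (M + M)
    ring : ∀ c → 4 * (c + c + 0) ≡ 2 * (4 * c)
    ring = solve-∀

  -- `count` misses ages 1 and 2 on the axes. The corner and the toothpick above it, four times each
  -- by symmetry, fill the gap, as `2 * t 1 + t 2` and `2 * t 2` are both 4.
  t-recurrence : ∀ i → 1 ≤ i → i < M + M → t (M + M + i) ≡ 2 * t i + t (suc i)
  t-recurrence 1 1≤i i< = trans (t-next 1 1≤i (<⇒≤ i<))
    (cong (4 *_) (cong₂ (λ u v → 1 + (u + u) + v) (count-early A (s≤s z≤n) (s≤s (s≤s z≤n))) (count-early A (s≤s z≤n) (s≤s (s≤s (s≤s z≤n))))))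
  t-recurrence 2 1≤i i< = begin
    t (M + M + 2)                                       ≡⟨ t-next 2 1≤i (<⇒≤ i<) ⟩
    4 * (1 + (count m f 2 + count m f 2) + count m f 3)
      ≡⟨ cong (λ u → 4 * (1 + (u + u) + count m f 3)) (count-early A (s≤s z≤n) (s≤s (s≤s (s≤s z≤n)))) ⟩
    4 * (1 + count m f 3)                               ≡⟨ *-distribˡ-+ 4 1 (count m f 3) ⟩
    4 + 4 * count m f 3                                 ≡⟨ cong (λ u → 4 + u) (sym (t-count A 3 ≤-refl i<)) ⟩
    4 + t 3                                             ∎
    where open ≡-Reasoning
  t-recurrence i@(suc (suc (suc _))) 1≤i i< = begin
    t (M + M + i)                    ≡⟨ t-next i 1≤i (<⇒≤ i<) ⟩
    4 * (0 + (c + c) + d)            ≡⟨ ring c d ⟩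
    2 * (4 * c) + 4 * d
      ≡⟨ cong₂ (λ u v → 2 * u + v) (sym (t-count A i 3≤i (<⇒≤ i<))) (sym (t-count A (suc i) (m≤n⇒m≤1+n 3≤i) i<)) ⟩
    2 * t i + t (suc i)              ∎
    where
    open ≡-Reasoning
    3≤i : 3 ≤ i
    3≤i = s≤s (s≤s (s≤s z≤n))
    c = count m f i
    d = count m f (suc i)
    ring : ∀ c d → 4 * (0 + (c + c) + d) ≡ 2 * (4 * c) + 4 * d
    ring = solve-∀

2M≡2^ : ∀ k → suc (pred2^ k) + suc (pred2^ k) ≡ 2 ^ suc (suc k)
2M≡2^ k = suc-pred2^ (suc k)

-- The smallest block has `M + M` = 4, so the exponents 0 and 1 are handled directly.
t-2^+ : ∀ k i → 1 ≤ i → i < 2 ^ k → t (2 ^ k + i) ≡ 2 * t i + t (suc i)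
t-2^+ zero (suc i) _ (s≤s ())
t-2^+ (suc zero) 1 _ _ = refl
t-2^+ (suc zero) (suc (suc i)) _ (s≤s (s≤s ()))
t-2^+ (suc (suc k)) i 1≤i i< = subst (λ u → t (u + i) ≡ 2 * t i + t (suc i)) (2M≡2^ k)
  (t-recurrence (ages k) i 1≤i (subst (i <_) (sym (2M≡2^ k)) i<))

t-2^ : ∀ k → t (2 ^ suc k) ≡ 2 ^ suc k
t-2^ zero          = refl
t-2^ (suc zero)    = refl
t-2^ (suc (suc k)) = begin
  t (2 ^ (3 + k))                    ≡⟨ cong t (2^suc (2 + k)) ⟩
  t (2 ^ (2 + k) + 2 ^ (2 + k))      ≡⟨ subst (λ u → t (u + u) ≡ 2 * t u) (2M≡2^ k) (t-double (ages k)) ⟩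
  2 * t (2 ^ (2 + k))                ≡⟨ cong (2 *_) (t-2^ (suc k)) ⟩
  2 ^ (3 + k)                        ∎
  where open ≡-Reasoning

-- Comparing `t` with the series

leading-bit : ∀ i → 1 ≤ i → ∃[ j ] ∃[ r ] r < 2 ^ j × i ≡ 2 ^ j + r
leading-bit 1 _ = 0 , 0 , s≤s z≤n , refl
leading-bit (suc (suc i)) _ with leading-bit (suc i) (s≤s z≤n)
... | j , r , r< , e with m≤n⇒m<n∨m≡n r<
...   | inj₁ 1+r< = j , suc r , 1+r< , trans (cong suc e) (sym (+-suc (2 ^ j) r))
...   | inj₂ 1+r≡ = suc j , 0 , 2^>0 (suc j) ,
        trans (cong suc e) (trans (sym (+-suc (2 ^ j) r)) (trans (cong (λ u → 2 ^ j + u) 1+r≡) (trans (sym (2^suc j)) (sym (+-identityʳ _)))))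

-- One use of the recurrence for `t` removes `k`. What remains concerns `i` alone and follows by
-- strong induction, where the exponent `j` of the leading bit of `i` takes the place of `k`.
t≡series : ∀ k i → i + 2 ≤ 2 ^ k → t (2 ^ k + 1 + i) ≡ 2 * series i
t≡series k i le = go (suc i) k i ≤-refl le
  where
  open ≡-Reasoning
  go : ∀ b k i → i < b → i + 2 ≤ 2 ^ k → t (2 ^ k + 1 + i) ≡ 2 * series i
  go (suc b) k i (s≤s i≤b) le = trans first (main i i≤b)
    where
    first : t (2 ^ k + 1 + i) ≡ 2 * t (suc i) + t (suc (suc i))
    first = trans (cong t (+-assoc (2 ^ k) 1 i)) (t-2^+ k (suc i) (s≤s z≤n) (subst (_≤ 2 ^ k) (+-comm i 2) le))

    main : ∀ i → i ≤ b → 2 * t (suc i) + t (suc (suc i)) ≡ 2 * series i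
    main zero _ = refl
    main i@(suc _) i≤b with leading-bit i (s≤s z≤n)
    ... | j , r , r< , e = by-gap (2 ^ j ∸ r) (m+[n∸m]≡n (<⇒≤ r<)) (m<n⇒0<n∸m r<)
      where
      1+i≡ : suc i ≡ 2 ^ j + 1 + r
      1+i≡ = trans (cong suc e) (ring (2 ^ j) r)
        where
        ring : ∀ p r → suc (p + r) ≡ p + 1 + r
        ring = solve-∀
      2+i≡ : suc (suc i) ≡ 2 ^ j + 1 + suc r
      2+i≡ = trans (cong suc 1+i≡) (sym (+-suc (2 ^ j + 1) r))
      r<b : r < b
      r<b = ≤-trans (subst (suc r ≤_) (sym e) (+-monoˡ-≤ r (2^>0 j))) i≤b
      t-r : r + 2 ≤ 2 ^ j → t (suc i) ≡ 2 * series r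
      t-r le = trans (cong t 1+i≡) (go b j r r<b le)

      by-gap : ∀ d → r + d ≡ 2 ^ j → 1 ≤ d → 2 * t (suc i) + t (suc (suc i)) ≡ 2 * series i
      -- All bits of `i` are 1, so `t` is taken at a power of two and just after it, where it is 4.
      by-gap 1 gap _ = begin
        2 * t (suc i) + t (suc (suc i))
          ≡⟨ cong₂ (λ u v → 2 * u + v) (trans (cong t 1+i≡2^) (t-2^ j)) (trans (cong t 2+i≡2^) (t-2^+ (suc j) 1 ≤-refl (^-monoʳ-≤ 2 (s≤s (z≤n {j}))))) ⟩
        2 * 2 ^ suc j + 2 * 2                   ≡⟨ sym (*-distribˡ-+ 2 (2 ^ suc j) 2) ⟩
        2 * (2 ^ suc j + 2)                     ≡⟨ cong (2 *_) (sym (series-2^∸1 j 1+i≡2^)) ⟩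
        2 * series i                            ∎
        where
        1+i≡2^ : suc i ≡ 2 ^ suc j
        1+i≡2^ = trans (cong suc e) (trans (ring (2 ^ j) r) (trans (cong (λ u → 2 ^ j + u) gap) (sym (2^suc j))))
          where
          ring : ∀ p r → suc (p + r) ≡ p + (r + 1)
          ring = solve-∀
        2+i≡2^ : suc (suc i) ≡ 2 ^ suc j + 1
        2+i≡2^ = trans (cong suc 1+i≡2^) (+-comm 1 (2 ^ suc j))
      -- Now `i` + 2 is a power of two, where the induction hypothesis does not apply to `suc r`;
      -- the exceptional value of `t` matches the defect in `series-penultimate`.
      by-gap 2 gap _ = begin
        2 * t (suc i) + t (suc (suc i))
          ≡⟨ cong₂ (λ u v → 2 * u + v) (t-r (≤-reflexive gap)) (trans (cong t 2+i≡2^) (t-2^ j)) ⟩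
        2 * (2 * series r) + 2 * 2 ^ j          ≡⟨ sym (*-distribˡ-+ 2 (2 * series r) (2 ^ j)) ⟩
        2 * (2 * series r + 2 ^ j)
          ≡⟨ cong (2 *_) (sym (trans (cong series e) (Split.series-penultimate j r gap))) ⟩
        2 * series i                            ∎
        where
        2+i≡2^ : suc (suc i) ≡ 2 ^ suc j
        2+i≡2^ = trans (cong (λ u → suc (suc u)) e) (trans (ring (2 ^ j) r) (trans (cong (λ u → 2 ^ j + u) gap) (sym (2^suc j))))
          where
          ring : ∀ p r → suc (suc (p + r)) ≡ p + (r + 2)
          ring = solve-∀
      by-gap d@(suc (suc (suc d′))) gap _ = begin
        2 * t (suc i) + t (suc (suc i))
          ≡⟨ cong₂ (λ u v → 2 * u + v) (t-r (subst (r + 2 ≤_) gap (+-monoʳ-≤ r (s≤s (s≤s z≤n))))) t-2+i ⟩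
        2 * (2 * series r) + 2 * series (suc r) ≡⟨ sym (*-distribˡ-+ 2 (2 * series r) (series (suc r))) ⟩
        2 * (2 * series r + series (suc r))
          ≡⟨ cong (2 *_) (sym (trans (cong series e) (Split.series-far j r gap (s≤s (s≤s (s≤s z≤n)))))) ⟩
        2 * series i                            ∎
        where
        1+r+2≤ : suc r + 2 ≤ 2 ^ j
        1+r+2≤ = subst₂ _≤_ (+-suc r 2) gap (+-monoʳ-≤ r (s≤s (s≤s (s≤s (z≤n {d′})))))
        1+r<b : suc r < b
        1+r<b = ≤-trans (≤-trans (+-monoˡ-≤ r (≤-trans (m≤n+m 2 (suc r)) 1+r+2≤)) (≤-reflexive (sym e))) i≤b
        t-2+i : t (suc (suc i)) ≡ 2 * series (suc r)
        t-2+i = trans (cong t 2+i≡) (go b j (suc r) 1+r<b 1+r+2≤)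

theorem9 : ((k i : ℕ) → i + 2 ≤ 2 ^ k → t (2 ^ k + 1 + i) ≡ 2 * series i)
    × ((k : ℕ) → t (2 ^ k + 1 + (2 ^ k ∸ 1)) ≡ 2 ^ (k + 1))
theorem9 = t≡series , t-last
  where
  t-last : ∀ k → t (2 ^ k + 1 + (2 ^ k ∸ 1)) ≡ 2 ^ (k + 1)
  t-last k = begin
    t (2 ^ k + 1 + (2 ^ k ∸ 1))
      ≡⟨ cong t (trans (+-assoc (2 ^ k) 1 _) (cong (λ u → 2 ^ k + u) (m+[n∸m]≡n (2^>0 k)))) ⟩
    t (2 ^ k + 2 ^ k)              ≡⟨ cong t (sym (2^suc k)) ⟩
    t (2 ^ suc k)                  ≡⟨ t-2^ k ⟩
    2 ^ suc k                      ≡⟨ cong (2 ^_) (+-comm 1 k) ⟩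
    2 ^ (k + 1)                    ∎
    where open ≡-Reasoning
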